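{- Let $n\geq 1$ and $k\ge 2$, and let $u$ be a word over $\Sigma_k$ of length at most $n$. Then $B_k(u,n)$ can be computed in $O(n^2)$ time using $O(n)$ space, under the unit-cost RAM model.
   Context: $\Sigma_k=\{1,2,\ldots,k\}$. A border of a word $w$ is a word that is both a non-empty proper prefix and a non-empty proper suffix of $w$; $w$ is bordered if it has a border. $B_k(u,n)$ denotes the number of length-$n$ bordered words over $\Sigma_k$ having $u$ as a prefix. Unit-cost RAM model: integer variables use constant space and integer arithmetic operations take constant time. -}

module Defs where

open import Data.Bool.Base using (if_then_else_)
open import Data.Fin.Base using (Fin; toℕ)
import Data.Fin.Properties as Fin
open import Data.Integer.Base as ℤ using (ℤ; +_; 0ℤ)
open import Data.List.Base using (List; []; _∷_; allFin; cartesianProductWith; drop; filter; head; inits; length; map)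
open import Data.List.Membership.Propositional using (_∈_; lose)
open import Data.List.Membership.Propositional.Properties using (∈-map⁺)
open import Data.List.Properties using (≡-dec)
open import Data.List.Relation.Binary.Prefix.Heterogeneous using (Prefix; []; _∷_)
open import Data.List.Relation.Binary.Prefix.Heterogeneous.Properties using (prefix?)
open import Data.List.Relation.Binary.Suffix.Heterogeneous using (Suffix)
open import Data.List.Relation.Binary.Suffix.Heterogeneous.Properties using (suffix?)
open import Data.List.Relation.Unary.All using (All)
open import Data.List.Relation.Unary.Any using (any?; here; there; satisfied)
open import Data.Maybe.Base using (Maybe; just; fromMaybe)
open import Data.Nat.Base using (ℕ; zero; suc; _<_)
open import Data.Nat.Properties using (_≟_)
open import Data.Product.Base using (∃; _×_; _,_; proj₁; proj₂)
open import Relation.Binary.Definitions using (DecidableEquality)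
open import Relation.Binary.PropositionalEquality using (_≡_; _≢_; refl)
open import Relation.Nullary using (¬_; Dec; does; ¬?; _×-dec_)
open import Relation.Nullary.Decidable using (map′)

-- The letter i of Fin k stands for the letter 1 + toℕ i of Σₖ = {1, …, k}.
Word : ℕ → Set
Word k = List (Fin k)

letter : ∀ {k} → Fin k → ℤ
letter i = + suc (toℕ i)

_≟ʷ_ : ∀ {k} → DecidableEquality (Word k)
_≟ʷ_ = ≡-dec Fin._≟_

_IsPrefixOf_ _IsSuffixOf_ : ∀ {k} → Word k → Word k → Set
_IsPrefixOf_ = Prefix _≡_
_IsSuffixOf_ = Suffix _≡_

Border : ∀ {k} → Word k → Word k → Set
Border b w = b ≢ [] × b ≢ w × b IsPrefixOf w × b IsSuffixOf w

Bordered : ∀ {k} → Word k → Set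
Bordered w = ∃ λ b → Border b w

border? : ∀ {k} (b w : Word k) → Dec (Border b w)
border? b w = ¬? (b ≟ʷ []) ×-dec ¬? (b ≟ʷ w) ×-dec prefix? Fin._≟_ b w ×-dec suffix? Fin._≟_ b w

prefix⇒∈inits : ∀ {k} {b w : Word k} → b IsPrefixOf w → b ∈ inits w
prefix⇒∈inits {w = []}    []         = here refl
prefix⇒∈inits {w = _ ∷ _} []         = here refl
prefix⇒∈inits             (refl ∷ p) = there (∈-map⁺ (_ ∷_) (prefix⇒∈inits p))

bordered? : ∀ {k} (w : Word k) → Dec (Bordered w)
bordered? w = map′ satisfied (λ (b , bd) → lose (prefix⇒∈inits (proj₁ (proj₂ (proj₂ bd)))) bd)
                   (any? (λ b → border? b w) (inits w))

-- Every word of length n occurs exactly once in this list.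
words : (k n : ℕ) → List (Word k)
words k zero    = [] ∷ []
words k (suc n) = cartesianProductWith _∷_ (allFin k) (words k n)

B : (k : ℕ) → Word k → ℕ → ℕ
B k u n = length (filter (λ w → prefix? Fin._≟_ u w ×-dec bordered? w) (words k n))

-- Unit-cost random access machine: registers R₀, R₁, R₂, … each hold an
-- arbitrary integer, and every executed instruction takes one unit of time.

Register Label : Set
Register = ℕ
Label    = ℕ

data Op : Set where
  add sub mul : Op

⟦_⟧ : Op → ℤ → ℤ → ℤ
⟦ add ⟧ = ℤ._+_
⟦ sub ⟧ = ℤ._-_
⟦ mul ⟧ = ℤ._*_

data Instr : Set where
  const : (d : Register) (c : ℤ) → Instr              -- R_d := c
  move  : (d a : Register) → Instr                    -- R_d := R_a
  arith : (op : Op) (d a b : Register) → Instr        -- R_d := R_a op R_b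
  div   : (d a b : Register) → Instr                  -- R_d := R_a / R_b
  load  : (d a : Register) → Instr                    -- R_d := R_{R_a}
  store : (a b : Register) → Instr                    -- R_{R_a} := R_b
  jump  : (ℓ : Label) → Instr                         -- goto ℓ
  jzero : (a : Register) (ℓ : Label) → Instr          -- if R_a = 0 goto ℓ
  jpos  : (a : Register) (ℓ : Label) → Instr          -- if R_a > 0 goto ℓ
  halt  : Instr

Program : Set
Program = List Instr

Memory : Set
Memory = Register → ℤ

_[_↦_] : Memory → Register → ℤ → Memory
(m [ r ↦ v ]) i = if does (i ≟ r) then v else m i

_‼_ : ∀ {A : Set} → List A → ℕ → Maybe A
xs ‼ i = head (drop i xs)

Config : Set
Config = Label × Memory

-- P ⊢ γ ⟶[ rs ] γ′ : one step of P leads from γ to γ′, and rs lists the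
-- registers it reads or writes.  The relation is deterministic; there is no
-- step for a division by zero, an indirect access through a negative address,
-- or a program counter outside P.
data _⊢_⟶[_]_ (P : Program) : Config → List Register → Config → Set where
  const : ∀ {pc m d c} → P ‼ pc ≡ just (const d c) →
          P ⊢ (pc , m) ⟶[ d ∷ [] ] (suc pc , m [ d ↦ c ])
  move  : ∀ {pc m d a} → P ‼ pc ≡ just (move d a) →
          P ⊢ (pc , m) ⟶[ d ∷ a ∷ [] ] (suc pc , m [ d ↦ m a ])
  arith : ∀ {pc m op d a b} → P ‼ pc ≡ just (arith op d a b) →
          P ⊢ (pc , m) ⟶[ d ∷ a ∷ b ∷ [] ] (suc pc , m [ d ↦ ⟦ op ⟧ (m a) (m b) ])
  div   : ∀ {pc m d a b} → P ‼ pc ≡ just (div d a b) → .{{_ : ℤ.NonZero (m b)}} →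
          P ⊢ (pc , m) ⟶[ d ∷ a ∷ b ∷ [] ] (suc pc , m [ d ↦ m a ℤ./ m b ])
  load  : ∀ {pc m d a i} → P ‼ pc ≡ just (load d a) → m a ≡ + i →
          P ⊢ (pc , m) ⟶[ d ∷ a ∷ i ∷ [] ] (suc pc , m [ d ↦ m i ])
  store : ∀ {pc m a b i} → P ‼ pc ≡ just (store a b) → m a ≡ + i →
          P ⊢ (pc , m) ⟶[ a ∷ b ∷ i ∷ [] ] (suc pc , m [ i ↦ m b ])
  jump  : ∀ {pc m ℓ} → P ‼ pc ≡ just (jump ℓ) →
          P ⊢ (pc , m) ⟶[ [] ] (ℓ , m)
  jzero-taken     : ∀ {pc m a ℓ} → P ‼ pc ≡ just (jzero a ℓ) → m a ≡ 0ℤ →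
                    P ⊢ (pc , m) ⟶[ a ∷ [] ] (ℓ , m)
  jzero-not-taken : ∀ {pc m a ℓ} → P ‼ pc ≡ just (jzero a ℓ) → m a ≢ 0ℤ →
                    P ⊢ (pc , m) ⟶[ a ∷ [] ] (suc pc , m)
  jpos-taken      : ∀ {pc m a ℓ} → P ‼ pc ≡ just (jpos a ℓ) → 0ℤ ℤ.< m a →
                    P ⊢ (pc , m) ⟶[ a ∷ [] ] (ℓ , m)
  jpos-not-taken  : ∀ {pc m a ℓ} → P ‼ pc ≡ just (jpos a ℓ) → ¬ (0ℤ ℤ.< m a) →
                    P ⊢ (pc , m) ⟶[ a ∷ [] ] (suc pc , m)

-- P ⊢ γ ⇓⟨ t , s ⟩ m : started in γ, P halts with final memory m after
-- executing exactly t instructions, and accesses only the registers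
-- R₀, …, R_{s-1}.
data _⊢_⇓⟨_,_⟩_ (P : Program) : Config → ℕ → ℕ → Memory → Set where
  halt : ∀ {pc m s} → P ‼ pc ≡ just halt → P ⊢ (pc , m) ⇓⟨ 1 , s ⟩ m
  step : ∀ {γ γ′ rs t s m} → P ⊢ γ ⟶[ rs ] γ′ → All (_< s) rs →
         P ⊢ γ′ ⇓⟨ t , s ⟩ m → P ⊢ γ ⇓⟨ suc t , s ⟩ m

-- R₀ = n, R₁ = k, R₂ = |u|, R₃ R₄ … = the letters of u, and 0 elsewhere.
input : (n k : ℕ) → Word k → Memory
input n k u i = fromMaybe 0ℤ ((+ n ∷ + k ∷ + length u ∷ map letter u) ‼ i)

-- The result is left in R₀.
_On_Computes_InTime_Space_ : Program → Memory → ℤ → ℕ → ℕ → Set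
P On m₀ Computes v InTime t Space s = ∃ λ m → P ⊢ (0 , m₀) ⇓⟨ t , s ⟩ m × m 0 ≡ v

{-# OPTIONS --safe #-}

-- Call two words compatible if one is a prefix of the other, and let U(m) be the
-- number of unbordered words of length m compatible with u.  A bordered word has
-- exactly one unbordered border, its shortest, and this border does not overlap
-- itself.  Splitting by its length j gives, for the number of bordered words,
--   Bd(m) = ∑_{1 ≤ j ≤ m/2} U(j) · W(m - j, j),     U(m) = k^(m ∸ |u|) - Bd(m),
-- where W(p, j) = [u_{p+i} = u_i whenever i < j and p + i < |u|] · k^(p ∸ max(j, |u|)).
-- For fixed p, the number W(p, j) is obtained from W(p, j - 1) by comparing two
-- letters or by dividing by k, so storing W(p, -) for every p makes each summand
-- cost O(1): quadratic time, and a linear number of registers.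

module Submission where

open import Defs
open import Data.Bool.Base using (Bool; true; false; T; _∨_; if_then_else_)
open import Data.Fin.Base as Fin using (Fin; zero; suc)
import Data.Fin.Properties as Fin
open import Data.Integer.Base as ℤ using (ℤ; 0ℤ)
import Data.Integer.DivMod as ℤ
import Data.Integer.Properties as ℤ
open import Data.List.Base using (List; []; _∷_; _++_; allFin; cartesianProductWith; drop; filter; head; length; map; tabulate; take)
open import Data.List.Properties using (++-assoc; ++-cancelˡ; ++-identityʳ; drop-all; drop-drop; length-++; length-drop; length-take; take++drop≡id; ∷-injective; ∷-injectiveʳ)
open import Data.List.Relation.Binary.Pointwise using (Pointwise-≡⇒≡; ≡⇒Pointwise-≡)
open import Data.List.Relation.Binary.Prefix.Heterogeneous using ([]; _∷_)
open import Data.List.Relation.Binary.Prefix.Heterogeneous.Properties using (prefix?)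
open import Data.List.Relation.Binary.Suffix.Heterogeneous using (here; there)
open import Data.List.Relation.Unary.All using (All; []; _∷_)
open import Data.Maybe.Base using (fromMaybe; just)
open import Data.Nat.Base
import Data.Nat.DivMod as ℕ
open import Data.Nat.Induction using (<-rec)
open import Data.Nat.Properties
open import Data.Nat.Solver using (module +-*-Solver)
open import Data.Product.Base using (∃-syntax; _×_; _,_; proj₁; proj₂)
open import Data.Sum.Base using (inj₁; inj₂)
open import Data.Unit.Base using (⊤; tt)
open import Function.Base using (_∘_; _$_; id)
open import Relation.Binary.PropositionalEquality
open import Relation.Nullary using (¬_; Dec; yes; no; does; ¬?; _×-dec_; contradiction)
open import Relation.Nullary.Decidable using (dec-true; dec-false)

-- Linear space rests on one cell per p. For length m and border length j the value needed is W(m -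
-- j, j), so when m grows by one, each p still in use moves to its next j exactly once, and the
-- value it moves from, W(p, j - 1), was used for length m - 1. The cell of p is created with W(p,
-- 0) once length p has been treated. Since j ≤ m/2 means j ≤ p, no cell has to advance beyond j =
-- p, and within that range the division by k is exact. Compatibility replaces "having u as a
-- prefix" because U(j) is also needed for j < |u|; the two notions coincide as soon as the length
-- reaches |u|. The machine adds an obstacle of its own: the letters of u may leave no register free
-- for scratch work, while k and |u| must survive. Only n can be given up, provided that it can be
-- recovered: it is turned into the address 64n, and a division by 64 restores it.

private variable
  k : ℕ
  A C D : Set

-- Indicators and finite sums.

𝟙 : {P : Set} → Dec P → ℕ
𝟙 p? = if does p? then 1 else 0

𝟙-yes : {P : Set} (p? : Dec P) → P → 𝟙 p? ≡ 1
𝟙-yes (yes _) _ = refl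
𝟙-yes (no ¬p) p = contradiction p ¬p

𝟙-no : {P : Set} (p? : Dec P) → ¬ P → 𝟙 p? ≡ 0
𝟙-no (yes p) ¬p = contradiction p ¬p
𝟙-no (no _)  _  = refl

𝟙-× : {P Q : Set} (p? : Dec P) (q? : Dec Q) → 𝟙 (p? ×-dec q?) ≡ 𝟙 p? * 𝟙 q?
𝟙-× p? q? with does p? | does q?
... | true  | true  = refl
... | true  | false = refl
... | false | _     = refl

𝟙-¬ : {P : Set} (p? : Dec P) → 𝟙 p? + 𝟙 (¬? p?) ≡ 1
𝟙-¬ p? with does p?
... | true  = refl
... | false = refl

∑ : List A → (A → ℕ) → ℕ
∑ []       f = 0
∑ (x ∷ xs) f = f x + ∑ xs f

∑-cong : (xs : List A) {f g : A → ℕ} → (∀ x → f x ≡ g x) → ∑ xs f ≡ ∑ xs g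
∑-cong []       h = refl
∑-cong (x ∷ xs) h = cong₂ _+_ (h x) (∑-cong xs h)

∑-++ : (xs ys : List A) (f : A → ℕ) → ∑ (xs ++ ys) f ≡ ∑ xs f + ∑ ys f
∑-++ []       ys f = refl
∑-++ (x ∷ xs) ys f = trans (cong (f x +_) (∑-++ xs ys f)) (sym (+-assoc (f x) _ _))

∑-map : (g : A → C) (xs : List A) (f : C → ℕ) → ∑ (map g xs) f ≡ ∑ xs (f ∘ g)
∑-map g []       f = refl
∑-map g (x ∷ xs) f = cong (f (g x) +_) (∑-map g xs f)

∑-cartesianProductWith : (_•_ : A → C → D) (xs : List A) (ys : List C) (f : D → ℕ) →
  ∑ (cartesianProductWith _•_ xs ys) f ≡ ∑ xs λ x → ∑ ys λ y → f (x • y)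
∑-cartesianProductWith _•_ []       ys f = refl
∑-cartesianProductWith _•_ (x ∷ xs) ys f =
  trans (∑-++ (map (x •_) ys) _ f)
        (cong₂ _+_ (∑-map (x •_) ys f) (∑-cartesianProductWith _•_ xs ys f))

*-distribˡ-∑ : ∀ c (xs : List A) (f : A → ℕ) → ∑ xs (λ x → c * f x) ≡ c * ∑ xs f
*-distribˡ-∑ c []       f = sym (*-zeroʳ c)
*-distribˡ-∑ c (x ∷ xs) f =
  trans (cong (c * f x +_) (*-distribˡ-∑ c xs f)) (sym (*-distribˡ-+ c (f x) _))

∑-+ : (xs : List A) (f g : A → ℕ) → ∑ xs (λ x → f x + g x) ≡ ∑ xs f + ∑ xs g
∑-+ []       f g = refl
∑-+ (x ∷ xs) f g = trans (cong (f x + g x +_) (∑-+ xs f g))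
  (solve 4 (λ a b c d → (a :+ b) :+ (c :+ d) := (a :+ c) :+ (b :+ d)) refl (f x) (g x) (∑ xs f) (∑ xs g))
  where open +-*-Solver

∑-zero : (xs : List A) → ∑ xs (λ _ → 0) ≡ 0
∑-zero []       = refl
∑-zero (x ∷ xs) = ∑-zero xs

length-filter≡∑ : {P : A → Set} (P? : ∀ x → Dec (P x)) (xs : List A) →
  length (filter P? xs) ≡ ∑ xs (𝟙 ∘ P?)
length-filter≡∑ P? []       = refl
length-filter≡∑ P? (x ∷ xs) with does (P? x)
... | true  = cong suc (length-filter≡∑ P? xs)
... | false = length-filter≡∑ P? xs

∑< : ℕ → (ℕ → ℕ) → ℕ
∑< zero    f = 0
∑< (suc n) f = ∑< n f + f n

∑<-cong : ∀ n {f g : ℕ → ℕ} → (∀ i → i < n → f i ≡ g i) → ∑< n f ≡ ∑< n g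
∑<-cong zero    h = refl
∑<-cong (suc n) h = cong₂ _+_ (∑<-cong n (λ i i<n → h i (m<n⇒m<1+n i<n))) (h n ≤-refl)

*-distribˡ-∑< : ∀ c n (f : ℕ → ℕ) → ∑< n (λ i → c * f i) ≡ c * ∑< n f
*-distribˡ-∑< c zero    f = sym (*-zeroʳ c)
*-distribˡ-∑< c (suc n) f =
  trans (cong (_+ c * f n) (*-distribˡ-∑< c n f)) (sym (*-distribˡ-+ c _ (f n)))

∑-∑<-swap : (xs : List A) (n : ℕ) (f : A → ℕ → ℕ) →
  ∑ xs (λ x → ∑< n (f x)) ≡ ∑< n (λ i → ∑ xs (λ x → f x i))
∑-∑<-swap xs zero    f = ∑-zero xs
∑-∑<-swap xs (suc n) f = trans (∑-+ xs _ _) (cong (_+ ∑ xs (λ x → f x n)) (∑-∑<-swap xs n f))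

∑<-none : ∀ n {P : ℕ → Set} (P? : ∀ i → Dec (P i)) → (∀ i → i < n → ¬ P i) → ∑< n (𝟙 ∘ P?) ≡ 0
∑<-none zero    P? none = refl
∑<-none (suc n) P? none =
  cong₂ _+_ (∑<-none n P? (λ i i<n → none i (m<n⇒m<1+n i<n))) (𝟙-no (P? n) (none n ≤-refl))

∑<-unique : ∀ n {P : ℕ → Set} (P? : ∀ i → Dec (P i)) →
  (∀ {i j} → i < n → j < n → P i → P j → i ≡ j) → ∀ {i} → i < n → P i → ∑< n (𝟙 ∘ P?) ≡ 1
∑<-unique (suc n) P? uniq i<1+n Pi with m<1+n⇒m<n∨m≡n i<1+n
... | inj₁ i<n  = cong₂ _+_ (∑<-unique n P? (λ p q → uniq (m<n⇒m<1+n p) (m<n⇒m<1+n q)) i<n Pi)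
                            (𝟙-no (P? n) λ Pn → <⇒≢ i<n (uniq i<1+n ≤-refl Pi Pn))
... | inj₂ refl = cong₂ _+_ (∑<-none n P? λ j j<n Pj → <⇒≢ j<n (uniq (m<n⇒m<1+n j<n) ≤-refl Pj Pi))
                            (𝟙-yes (P? n) Pi)

∑-tabulate : ∀ {n} (g : Fin n → A) (f : A → ℕ) → ∑ (tabulate g) f ≡ ∑ (allFin n) (f ∘ g)
∑-tabulate {n = zero}  g f = refl
∑-tabulate {n = suc n} g f = cong (f (g zero) +_)
  (trans (∑-tabulate (g ∘ suc) f) (sym (∑-tabulate suc (f ∘ g))))

∑-allFin-const : ∀ n c → ∑ (allFin n) (λ _ → c) ≡ n * c
∑-allFin-const zero    c = refl
∑-allFin-const (suc n) c = cong (c +_) (trans (∑-tabulate {n = n} Fin.suc (λ _ → c)) (∑-allFin-const n c))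

∑-allFin-pick : ∀ {n} (x : Fin n) (f : Fin n → ℕ) → ∑ (allFin n) (λ y → 𝟙 (x Fin.≟ y) * f y) ≡ f x
∑-allFin-pick {suc n} zero f = trans
  (cong₂ _+_ (*-identityˡ (f zero)) (trans (∑-tabulate {n = n} Fin.suc (λ y → 𝟙 (Fin.zero {n} Fin.≟ y) * f y)) (∑-zero (allFin n))))
  (+-identityʳ (f zero))
∑-allFin-pick {suc n} (suc x) f = trans (∑-tabulate {n = n} Fin.suc (λ y → 𝟙 (Fin.suc x Fin.≟ y) * f y)) (∑-allFin-pick x (f ∘ suc))

-- Sums over all words of a given length.

∑-words-suc : ∀ k n (f : Word k → ℕ) →
  ∑ (words k (suc n)) f ≡ ∑ (allFin k) λ x → ∑ (words k n) λ w → f (x ∷ w)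
∑-words-suc k n f = ∑-cartesianProductWith _∷_ (allFin k) (words k n) f

∑-words-cong : ∀ n {f g : Word k → ℕ} → (∀ w → length w ≡ n → f w ≡ g w) →
  ∑ (words k n) f ≡ ∑ (words k n) g
∑-words-cong zero h = cong (_+ 0) (h [] refl)
∑-words-cong {k} (suc n) {f} {g} h = begin
  ∑ (words k (suc n)) f                          ≡⟨ ∑-words-suc k n f ⟩
  ∑ (allFin k) (λ x → ∑ (words k n) (f ∘ (x ∷_))) ≡⟨ ∑-cong (allFin k) (λ x → ∑-words-cong n (λ w eq → h (x ∷ w) (cong suc eq))) ⟩
  ∑ (allFin k) (λ x → ∑ (words k n) (g ∘ (x ∷_))) ≡⟨ ∑-words-suc k n g ⟨
  ∑ (words k (suc n)) g                          ∎
  where open ≡-Reasoning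

∑-words-++ : ∀ m n (f : Word k → ℕ) →
  ∑ (words k (m + n)) f ≡ ∑ (words k m) λ v → ∑ (words k n) λ w → f (v ++ w)
∑-words-++ zero n f = sym (+-identityʳ _)
∑-words-++ {k} (suc m) n f = begin
  ∑ (words k (suc m + n)) f
    ≡⟨ ∑-words-suc k (m + n) f ⟩
  ∑ (allFin k) (λ x → ∑ (words k (m + n)) (f ∘ (x ∷_)))
    ≡⟨ ∑-cong (allFin k) (λ x → ∑-words-++ m n (f ∘ (x ∷_))) ⟩
  ∑ (allFin k) (λ x → ∑ (words k m) λ v → ∑ (words k n) λ w → f (x ∷ v ++ w))
    ≡⟨ ∑-words-suc k m _ ⟨
  ∑ (words k (suc m)) (λ v → ∑ (words k n) λ w → f (v ++ w)) ∎
  where open ≡-Reasoning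

-- Each word occurs exactly once in `words`, so a single summand survives. This is what ties the
-- suffix of a word to its prefix when the words with a given border are counted.
∑-words-pick : (v : Word k) (f : Word k → ℕ) →
  ∑ (words k (length v)) (λ w → 𝟙 (v ≟ʷ w) * f w) ≡ f v
∑-words-pick [] f = trans (+-identityʳ _) (*-identityˡ (f []))
∑-words-pick {k} (x ∷ v) f = begin
  ∑ (words k (suc (length v))) (λ w → 𝟙 ((x ∷ v) ≟ʷ w) * f w)
    ≡⟨ ∑-words-suc k (length v) _ ⟩
  ∑ (allFin k) (λ y → ∑ (words k (length v)) λ w → 𝟙 ((x ∷ v) ≟ʷ (y ∷ w)) * f (y ∷ w))
    ≡⟨ ∑-cong (allFin k) (λ y → trans
         (∑-cong (words k (length v)) λ w → trans
           (cong (_* f (y ∷ w)) (𝟙-× (x Fin.≟ y) (v ≟ʷ w)))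
           (*-assoc (𝟙 (x Fin.≟ y)) _ _))
         (trans (*-distribˡ-∑ (𝟙 (x Fin.≟ y)) (words k (length v)) _)
                (cong (𝟙 (x Fin.≟ y) *_) (∑-words-pick v (f ∘ (y ∷_)))))) ⟩
  ∑ (allFin k) (λ y → 𝟙 (x Fin.≟ y) * f (y ∷ v))
    ≡⟨ ∑-allFin-pick x _ ⟩
  f (x ∷ v) ∎
  where open ≡-Reasoning

-- Compatibility of words.

compat : Word k → Word k → ℕ
compat []      w       = 1
compat (x ∷ u) []      = 1
compat (x ∷ u) (y ∷ w) = 𝟙 (x Fin.≟ y) * compat u w

compat-[]ʳ : (u : Word k) → compat u [] ≡ 1
compat-[]ʳ []      = refl
compat-[]ʳ (x ∷ u) = refl

compat-++ʳ : (u v w : Word k) → compat u (v ++ w) ≡ compat u v * compat (drop (length v) u) w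
compat-++ʳ []      []      w = refl
compat-++ʳ []      (y ∷ v) w = refl
compat-++ʳ (x ∷ u) []      w = sym (+-identityʳ _)
compat-++ʳ (x ∷ u) (y ∷ v) w =
  trans (cong (𝟙 (x Fin.≟ y) *_) (compat-++ʳ u v w)) (sym (*-assoc (𝟙 (x Fin.≟ y)) _ _))

prefix?≡compat : (u w : Word k) → length u ≤ length w → 𝟙 (prefix? Fin._≟_ u w) ≡ compat u w
prefix?≡compat []      w       _       = refl
prefix?≡compat (x ∷ u) (y ∷ w) (s≤s p) =
  trans (𝟙-× (x Fin.≟ y) (prefix? Fin._≟_ u w)) (cong (𝟙 (x Fin.≟ y) *_) (prefix?≡compat u w p))

-- The letters below `length u` are forced and the others free. For `n` below `length u` the
-- truncated exponent 0 gives the one compatible word, `take n u`.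
∑-compat : (u : Word k) (n : ℕ) → ∑ (words k n) (compat u) ≡ k ^ (n ∸ length u)
∑-compat []      zero = refl
∑-compat (x ∷ u) zero = refl
∑-compat {k} [] (suc n) = trans (∑-words-suc k n _)
  (trans (∑-cong (allFin k) (λ _ → ∑-compat [] n)) (∑-allFin-const k (k ^ n)))
∑-compat {k} (x ∷ u) (suc n) = trans (∑-words-suc k n _)
  (trans (∑-cong (allFin k) (λ y → trans (*-distribˡ-∑ (𝟙 (x Fin.≟ y)) (words k n) _)
                                         (cong (𝟙 (x Fin.≟ y) *_) (∑-compat u n))))
         (∑-allFin-pick x _))

-- If `v` is compatible with `u` and not longer, it is `take (length v) u`; otherwise both sides
-- vanish.
compat-replace : (u v : Word k) (f : Word k → ℕ) → length v ≤ length u →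
  compat u v * f v ≡ compat u v * f (take (length v) u)
compat-replace u       []      f _ = refl
compat-replace (x ∷ u) (y ∷ v) f (s≤s p) with x Fin.≟ y
... | yes refl = begin
  (1 * compat u v) * f (x ∷ v)                     ≡⟨ cong (_* f (x ∷ v)) (*-identityˡ (compat u v)) ⟩
  compat u v * f (x ∷ v)                           ≡⟨ compat-replace u v (f ∘ (x ∷_)) p ⟩
  compat u v * f (x ∷ take (length v) u)           ≡⟨ cong (_* f (x ∷ take (length v) u)) (*-identityˡ (compat u v)) ⟨
  (1 * compat u v) * f (x ∷ take (length v) u)     ∎
  where open ≡-Reasoning
... | no _ = refl

-- Borders and unbordered borders.

prefix⇒++ : {b w : Word k} → b IsPrefixOf w → ∃[ x ] b ++ x ≡ w
prefix⇒++ []         = _ , refl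
prefix⇒++ (refl ∷ p) with x , eq ← prefix⇒++ p = x , cong (_ ∷_) eq

++⇒prefix : (b x : Word k) → b IsPrefixOf (b ++ x)
++⇒prefix []      x = []
++⇒prefix (_ ∷ b) x = refl ∷ ++⇒prefix b x

suffix⇒++ : {b w : Word k} → b IsSuffixOf w → ∃[ y ] y ++ b ≡ w
suffix⇒++ (here eq) = [] , Pointwise-≡⇒≡ eq
suffix⇒++ (there s) with y , eq ← suffix⇒++ s = _ ∷ y , cong (_ ∷_) eq

++⇒suffix : (y b : Word k) → b IsSuffixOf (y ++ b)
++⇒suffix []      b = here (≡⇒Pointwise-≡ refl)
++⇒suffix (_ ∷ y) b = there (++⇒suffix y b)

border⇒≢[] : {b w : Word k} → Border b w → b ≢ []
border⇒≢[] = proj₁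

border⇒++ˡ : {b w : Word k} → Border b w → ∃[ x ] b ++ x ≡ w
border⇒++ˡ (_ , _ , p , _) = prefix⇒++ p

border⇒++ʳ : {b w : Word k} → Border b w → ∃[ y ] y ++ b ≡ w
border⇒++ʳ (_ , _ , _ , s) = suffix⇒++ s

≢[]⇒0<length : {w : Word k} → w ≢ [] → 0 < length w
≢[]⇒0<length {w = []}    w≢[] = contradiction refl w≢[]
≢[]⇒0<length {w = _ ∷ _} w≢[] = z<s

border-length : {b w : Word k} → Border b w → length b < length w
border-length {b = b} bd@(_ , b≢w , _) with border⇒++ˡ bd
... | x , refl = subst (length b <_) (sym (length-++ b))
  (m<m+n (length b) (≢[]⇒0<length {w = x} λ { refl → b≢w (sym (++-identityʳ b)) }))

mkBorder : {b w : Word k} → b ≢ [] → length b < length w →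
           ∃[ x ] b ++ x ≡ w → ∃[ y ] y ++ b ≡ w → Border b w
mkBorder {b = b} b≢[] b<w (x , eq) (y , eq′) =
  b≢[] , (λ b≡w → <⇒≢ b<w (cong length b≡w)) ,
  subst (b IsPrefixOf_) eq (++⇒prefix b x) , subst (b IsSuffixOf_) eq′ (++⇒suffix y b)

border-trans : {c b w : Word k} → Border c b → Border b w → Border c w
border-trans {c = c} cb bw
  with x , refl ← border⇒++ˡ cb | y , eq ← border⇒++ʳ cb | x′ , refl ← border⇒++ˡ bw | y′ , eq′ ← border⇒++ʳ bw =
  mkBorder (border⇒≢[] cb) (<-trans (border-length cb) (border-length bw))
    (x ++ x′ , sym (++-assoc c x x′))
    (y′ ++ y , trans (++-assoc y′ y c) (trans (cong (y′ ++_) eq) eq′))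

common-prefix : (b c : Word k) {x y : Word k} → b ++ x ≡ c ++ y → length b ≤ length c → ∃[ z ] b ++ z ≡ c
common-prefix []      c       eq _       = c , refl
common-prefix (a ∷ b) (a′ ∷ c) eq (s≤s p) with ∷-injective eq
... | refl , eq′ with z , eq″ ← common-prefix b c eq′ p = z , cong (a ∷_) eq″

common-suffix : (x y : Word k) {b c : Word k} → x ++ b ≡ y ++ c → length b ≤ length c → ∃[ z ] z ++ b ≡ c
common-suffix x       []      eq _ = x , eq
common-suffix []      (a ∷ y) {b} {c} eq p = contradiction p (<⇒≱ (subst (length c <_) (sym (cong length eq))
  (s≤s (subst (length c ≤_) (sym (length-++ y)) (m≤n+m (length c) (length y))))))
common-suffix (_ ∷ x) (_ ∷ y) eq p = common-suffix x y (∷-injectiveʳ eq) p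

border-nested : {b c w : Word k} → Border b w → Border c w → length b < length c → Border b c
border-nested {b = b} {c} bw cw b<c
  with x , eq ← border⇒++ˡ bw | y , eq′ ← border⇒++ʳ bw | x′ , refl ← border⇒++ˡ cw | y′ , eq″ ← border⇒++ʳ cw =
  mkBorder (border⇒≢[] bw) b<c (common-prefix b c eq (<⇒≤ b<c))
                               (common-suffix y y′ (trans eq′ (sym eq″)) (<⇒≤ b<c))

-- A border longer than half of w overlaps itself, and the overlap is a border of it.
unbordered-border-short : {b w : Word k} → Border b w → ¬ Bordered b → length b + length b ≤ length w
unbordered-border-short {b = b} {w} bw unb
  with x , eqx ← border⇒++ˡ bw | y , eqy ← border⇒++ʳ bw = ≮⇒≥ long
  where
  |y|+|b| : length y + length b ≡ length w
  |y|+|b| = trans (sym (length-++ y)) (cong length eqy)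
  0<|y| : 0 < length y
  0<|y| = +-cancelʳ-< (length b) 0 (length y) (subst (length b <_) (sym |y|+|b|) (border-length bw))
  long : ¬ (length w < length b + length b)
  long w<2b with +-cancelʳ-< (length b) (length y) (length b) (subst (_< length b + length b) (sym |y|+|b|) w<2b)
  ... | y<b with common-prefix y b (trans eqy (sym eqx)) (<⇒≤ y<b)
  ... | c , y++c≡b = unb (c , mkBorder c≢[] c<b (x , sym b≡c++x) (y , y++c≡b))
    where
    c≢[] : c ≢ []
    c≢[] refl = <⇒≢ y<b (cong length (trans (sym (++-identityʳ y)) y++c≡b))
    c<b : length c < length b
    c<b = subst (length c <_) (trans (sym (length-++ y)) (cong length y++c≡b)) (m<n+m (length c) 0<|y|)
    -- Here y ++ b = b ++ x and b = y ++ c; cancelling y leaves this second factorisation.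
    b≡c++x : b ≡ c ++ x
    b≡c++x = ++-cancelˡ y b (c ++ x)
      (trans eqy (trans (sym eqx) (trans (cong (_++ x) (sym y++c≡b)) (++-assoc y c x))))

-- Borders of borders are borders, so the descent to shorter ones ends at an unbordered one.
unbordered-border : {w : Word k} → Bordered w → ∃[ b ] Border b w × ¬ Bordered b
unbordered-border {k} {w} (b , bw) = <-rec Q descend (length b) b refl bw
  where
  Q : ℕ → Set
  Q n = (b : Word k) → length b ≡ n → Border b w → ∃[ b ] Border b w × ¬ Bordered b
  descend : ∀ n → (∀ {m} → m < n → Q m) → Q n
  descend _ rec b refl bw with bordered? b
  ... | yes (c , cb) = rec (border-length cb) c refl (border-trans cb bw)
  ... | no unb       = b , bw , unb

-- Of two borders with different lengths the shorter is a border of the longer.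
unbordered-border-unique : {b c w : Word k} → Border b w → ¬ Bordered b → Border c w → ¬ Bordered c → length b ≡ length c
unbordered-border-unique {b = b} {c} bw unb cw unc = ≤-antisym
  (≮⇒≥ λ c<b → unb (c , border-nested cw bw c<b)) (≮⇒≥ λ b<c → unc (b , border-nested bw cw b<c))

-- The shortest border, found by its length.

take-length-++ : (v w : List A) → take (length v) (v ++ w) ≡ v
take-length-++ []      w = refl
take-length-++ (x ∷ v) w = cong (x ∷_) (take-length-++ v w)

drop-length-++ : (v w : List A) → drop (length v) (v ++ w) ≡ w
drop-length-++ []      w = refl
drop-length-++ (x ∷ v) w = drop-length-++ v w

length-take-≤ : ∀ j (w : List A) → j ≤ length w → length (take j w) ≡ j
length-take-≤ j w j≤w = trans (length-take j w) (m≤n⇒m⊓n≡m j≤w)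

border⇒take≡drop : {b w : Word k} → Border b w →
  take (length b) w ≡ b × drop (length w ∸ length b) w ≡ b
border⇒take≡drop {b = b} {w} bw with x , eqx ← border⇒++ˡ bw | y , refl ← border⇒++ʳ bw =
  trans (cong (take (length b)) (sym eqx)) (take-length-++ b x) ,
  trans (cong (λ l → drop l (y ++ b)) (trans (cong (_∸ length b) (length-++ y)) (m+n∸n≡m (length y) (length b))))
        (drop-length-++ y b)

take≡drop⇒border : ∀ j (w : Word k) → suc j < length w →
  take (suc j) w ≡ drop (length w ∸ suc j) w → Border (take (suc j) w) w
take≡drop⇒border j w j<w eq = mkBorder
  (λ e → contradiction (trans (sym (length-take-≤ (suc j) w (<⇒≤ j<w))) (cong length e)) λ ())
  (subst (_< length w) (sym (length-take-≤ (suc j) w (<⇒≤ j<w))) j<w)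
  (drop (suc j) w , take++drop≡id (suc j) w)
  (take (length w ∸ suc j) w , trans (cong (take (length w ∸ suc j) w ++_) eq) (take++drop≡id (length w ∸ suc j) w))

i<⌊n/2⌋⇒2i+2≤n : ∀ {i n} → i < ⌊ n /2⌋ → suc i + suc i ≤ n
i<⌊n/2⌋⇒2i+2≤n {n = n} p = ≤-trans (+-mono-≤ p (≤-trans p (⌊n/2⌋≤⌈n/2⌉ n))) (≤-reflexive (⌊n/2⌋+⌈n/2⌉≡n n))

2i≤n⇒i≤⌊n/2⌋ : ∀ {i n} → i + i ≤ n → i ≤ ⌊ n /2⌋
2i≤n⇒i≤⌊n/2⌋ {i} {n} p = subst (_≤ ⌊ n /2⌋) (sym (n≡⌊n+n/2⌋ i)) (⌊n/2⌋-mono p)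

-- Described by slices of `w`, so that a border becomes a number to sum over. For 0 < j < `length w`
-- it says that `take j w` is an unbordered border.
ShortestBorder : Word k → ℕ → Set
ShortestBorder w j = ¬ Bordered (take j w) × take j w ≡ drop (length w ∸ j) w

shortestBorder? : (w : Word k) (j : ℕ) → Dec (ShortestBorder w j)
shortestBorder? w j = ¬? (bordered? (take j w)) ×-dec (take j w ≟ʷ drop (length w ∸ j) w)

-- Uniqueness bounds the sum by 1, and existence together with the bound by half the length makes it
-- 1 for bordered words. The shift `suc i` leaves out the empty prefix, which would satisfy
-- `ShortestBorder`.
bordered≡∑< : (w : Word k) → 𝟙 (bordered? w) ≡ ∑< ⌊ length w /2⌋ (λ i → 𝟙 (shortestBorder? w (suc i)))
bordered≡∑< {k} w = cases (bordered? w)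
  where
  short : ∀ {i} → i < ⌊ length w /2⌋ → suc i < length w
  short {i} p = ≤-trans (m<m+n (suc i) z<s) (i<⌊n/2⌋⇒2i+2≤n p)
  uniq : ∀ {i j} → i < ⌊ length w /2⌋ → j < ⌊ length w /2⌋ →
    ShortestBorder w (suc i) → ShortestBorder w (suc j) → i ≡ j
  uniq {i} {j} p q (ui , ei) (uj , ej) = suc-injective (begin
    suc i                   ≡⟨ length-take-≤ (suc i) w (<⇒≤ (short p)) ⟨
    length (take (suc i) w) ≡⟨ unbordered-border-unique (take≡drop⇒border i w (short p) ei) ui
                                                        (take≡drop⇒border j w (short q) ej) uj ⟩
    length (take (suc j) w) ≡⟨ length-take-≤ (suc j) w (<⇒≤ (short q)) ⟩
    suc j                   ∎)
    where open ≡-Reasoning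
  cases : Dec (Bordered w) → 𝟙 (bordered? w) ≡ ∑< ⌊ length w /2⌋ (λ i → 𝟙 (shortestBorder? w (suc i)))
  cases (no unb) = trans (𝟙-no (bordered? w) unb)
    (sym (∑<-none ⌊ length w /2⌋ (shortestBorder? w ∘ suc)
      λ i i<h (_ , eq) → unb (_ , take≡drop⇒border i w (short i<h) eq)))
  cases (yes bd) with unbordered-border bd
  ... | [] , bw , _ = contradiction refl (border⇒≢[] bw)
  ... | b@(_ ∷ _) , bw , unb = trans (𝟙-yes (bordered? w) bd)
    (sym (∑<-unique ⌊ length w /2⌋ (shortestBorder? w ∘ suc) uniq
      (2i≤n⇒i≤⌊n/2⌋ (unbordered-border-short bw unb))
      (subst (λ v → ¬ Bordered v) (sym (proj₁ (border⇒take≡drop bw))) unb ,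
       trans (proj₁ (border⇒take≡drop bw)) (sym (proj₂ (border⇒take≡drop bw))))))

-- Compatibility letter by letter.

-- By computation this is the content of register 3 + i in `input n k u`, default included. The
-- registers R₃ to R₈ can therefore be saved without asking how long `u` is.
letterAt : Word k → ℕ → ℤ
letterAt w i = fromMaybe 0ℤ (map letter w ‼ i)

letter-injective : {x y : Fin k} → letter x ≡ letter y → x ≡ y
letter-injective eq = Fin.toℕ-injective (suc-injective (ℤ.+-injective eq))

letterAt-drop : ∀ p (w : Word k) i → letterAt (drop p w) i ≡ letterAt w (p + i)
letterAt-drop zero    w       i       = refl
letterAt-drop (suc p) []      zero    = refl
letterAt-drop (suc p) []      (suc i) = refl
letterAt-drop (suc p) (x ∷ w) i       = letterAt-drop p w i

compat-take-match : ∀ i (v w : Word k) → i < length v → i < length w → letterAt v i ≡ letterAt w i →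
  compat v (take (suc i) w) ≡ compat v (take i w)
compat-take-match zero (x ∷ v) (y ∷ w) _ _ eq =
  cong₂ _*_ (𝟙-yes (x Fin.≟ y) (letter-injective eq)) (compat-[]ʳ v)
compat-take-match (suc i) (x ∷ v) (y ∷ w) (s≤s p) (s≤s q) eq =
  cong (𝟙 (x Fin.≟ y) *_) (compat-take-match i v w p q eq)

compat-take-mismatch : ∀ i (v w : Word k) → i < length v → i < length w → letterAt v i ≢ letterAt w i →
  compat v (take (suc i) w) ≡ 0
compat-take-mismatch zero (x ∷ v) (y ∷ w) _ _ neq =
  cong (_* compat v []) (𝟙-no (x Fin.≟ y) λ eq → neq (cong letter eq))
compat-take-mismatch (suc i) (x ∷ v) (y ∷ w) (s≤s p) (s≤s q) neq =
  trans (cong (𝟙 (x Fin.≟ y) *_) (compat-take-mismatch i v w p q neq)) (*-zeroʳ (𝟙 (x Fin.≟ y)))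

compat-take-long : ∀ i (v w : Word k) → length v ≤ i → compat v (take (suc i) w) ≡ compat v (take i w)
compat-take-long i       []      w       _       = refl
compat-take-long (suc i) (x ∷ v) []      _       = refl
compat-take-long (suc i) (x ∷ v) (y ∷ w) (s≤s p) = cong (𝟙 (x Fin.≟ y) *_) (compat-take-long i v w p)

-- The recurrence and the update rules for its weights.

module Recurrence {k : ℕ} (u : Word k) where

  bordered unbordered : ℕ → ℕ
  bordered   m = ∑ (words k m) λ w → compat u w * 𝟙 (bordered? w)
  unbordered m = ∑ (words k m) λ w → compat u w * 𝟙 (¬? (bordered? w))

  B≡bordered : ∀ {n} → length u ≤ n → B k u n ≡ bordered n
  B≡bordered {n} u≤n = trans (length-filter≡∑ _ (words k n)) (∑-words-cong n λ { w refl →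
    trans (𝟙-× (prefix? Fin._≟_ u w) (bordered? w)) (cong (_* 𝟙 (bordered? w)) (prefix?≡compat u w u≤n)) })

  bordered+unbordered : ∀ m → bordered m + unbordered m ≡ k ^ (m ∸ length u)
  bordered+unbordered m = begin
    bordered m + unbordered m
      ≡⟨ ∑-+ (words k m) _ _ ⟨
    ∑ (words k m) (λ w → compat u w * 𝟙 (bordered? w) + compat u w * 𝟙 (¬? (bordered? w)))
      ≡⟨ ∑-cong (words k m) (λ w → trans (sym (*-distribˡ-+ (compat u w) _ _))
           (trans (cong (compat u w *_) (𝟙-¬ (bordered? w))) (*-identityʳ _))) ⟩
    ∑ (words k m) (compat u)
      ≡⟨ ∑-compat u m ⟩
    k ^ (m ∸ length u) ∎
    where open ≡-Reasoning

  -- For v of length j ≤ p compatible with u, the number of words of length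
  -- p + j compatible with u that have v both as a prefix and as a suffix.
  weight : ℕ → ℕ → ℕ
  weight p j = compat (drop p u) (take j u) * k ^ (p ∸ (j ⊔ length u))

  -- The left side counts the free letters in a block of length r that starts at position j; the
  -- right side is the exponent of `weight` at p = j + r.
  ∸-⊔ : ∀ j r l → r ∸ (l ∸ j) ≡ (j + r) ∸ (j ⊔ l)
  ∸-⊔ j r l with ≤-total j l
  ... | inj₁ j≤l = begin
    r ∸ (l ∸ j)             ≡⟨ [m+n]∸[m+o]≡n∸o j r (l ∸ j) ⟨
    (j + r) ∸ (j + (l ∸ j)) ≡⟨ cong (j + r ∸_) (m+[n∸m]≡n j≤l) ⟩
    (j + r) ∸ l             ≡⟨ cong (j + r ∸_) (m≤n⇒m⊔n≡n j≤l) ⟨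
    (j + r) ∸ (j ⊔ l)       ∎
    where open ≡-Reasoning
  ... | inj₂ l≤j = begin
    r ∸ (l ∸ j)             ≡⟨ cong (r ∸_) (m≤n⇒m∸n≡0 l≤j) ⟩
    r                       ≡⟨ m+n∸m≡n j r ⟨
    (j + r) ∸ j             ≡⟨ cong (j + r ∸_) (m≥n⇒m⊔n≡m l≤j) ⟨
    (j + r) ∸ (j ⊔ l)       ∎
    where open ≡-Reasoning

  -- Makes the constraint on the second copy of `v` independent of `v`, so that it leaves the sum
  -- over `v`. If `v` is at least as long as `u`, the second copy starts behind `u` and is not
  -- constrained.
  self-overlap : ∀ p v → length v ≤ p →
    compat u v * compat (drop p u) v ≡ compat u v * compat (drop p u) (take (length v) u)
  self-overlap p v v≤p with ≤-total (length v) (length u)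
  ... | inj₁ v≤u = compat-replace u v (compat (drop p u)) v≤u
  ... | inj₂ u≤v = cong (λ z → compat u v * z) (trans
    (cong (λ z → compat z v) (drop-all p u (≤-trans u≤v v≤p)))
    (cong (λ z → compat z (take (length v) u)) (sym (drop-all p u (≤-trans u≤v v≤p)))))

  -- A word of length m is cut as v ++ x ++ v′ with blocks of lengths j, r, j. The border condition
  -- forces v′ = v, the block x contributes a power of k, and what remains of the sum over v is
  -- `unbordered j`.
  framed : ∀ j r → let m = j + (r + j) in
    ∑ (words k m) (λ w → compat u w * 𝟙 (¬? (bordered? (take j w)) ×-dec (take j w ≟ʷ drop (m ∸ j) w)))
    ≡ unbordered j * weight (j + r) j
  framed j r = begin
    ∑ (words k (j + (r + j))) f
      ≡⟨ trans (∑-words-++ j (r + j) f) (∑-cong (words k j) λ v → ∑-words-++ r j (f ∘ (v ++_))) ⟩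
    ∑ (words k j) (λ v → ∑ (words k r) λ x → ∑ (words k j) λ v′ → f (v ++ (x ++ v′)))
      ≡⟨ ∑-words-cong j (λ v v≡ → trans
           (∑-words-cong r λ x x≡ → trans (∑-words-cong j λ v′ v′≡ → term v x v′ v≡ x≡ v′≡) (inner v x v≡))
           (trans (*-distribˡ-∑ (g v) (words k r) _) (cong (g v *_) (∑-compat (drop j u) r)))) ⟩
    ∑ (words k j) (λ v → g v * k ^ (r ∸ length (drop j u)))
      ≡⟨ ∑-words-cong j regroup ⟩
    ∑ (words k j) (λ v → weight p j * (compat u v * ub v))
      ≡⟨ *-distribˡ-∑ (weight p j) (words k j) _ ⟩
    weight p j * unbordered j
      ≡⟨ *-comm (weight p j) _ ⟩
    unbordered j * weight p j ∎
    where
    open ≡-Reasoning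
    open +-*-Solver
    p m : ℕ
    p = j + r
    m = j + (r + j)
    ub : Word k → ℕ
    ub v = 𝟙 (¬? (bordered? v))
    f : Word k → ℕ
    f w = compat u w * 𝟙 (¬? (bordered? (take j w)) ×-dec (take j w ≟ʷ drop (m ∸ j) w))
    g : Word k → ℕ
    g v = (compat u v * compat (drop p u) v) * ub v
    term : ∀ v x v′ → length v ≡ j → length x ≡ r → length v′ ≡ j → f (v ++ (x ++ v′)) ≡
      𝟙 (v ≟ʷ v′) * (compat u v * compat (drop j u) x * compat (drop p u) v′ * ub v)
    term v x v′ refl refl v′≡ = begin
      f (v ++ (x ++ v′))
        ≡⟨ cong₂ (λ a b → compat u (v ++ (x ++ v′)) * 𝟙 (¬? (bordered? a) ×-dec (a ≟ʷ b)))
             (take-length-++ v _)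
             (trans (cong (λ l → drop l (v ++ (x ++ v′))) m∸j)
               (trans (sym (drop-drop (length v) (length x) _))
                 (trans (cong (drop (length x)) (drop-length-++ v _)) (drop-length-++ x v′)))) ⟩
      compat u (v ++ (x ++ v′)) * 𝟙 (¬? (bordered? v) ×-dec (v ≟ʷ v′))
        ≡⟨ cong₂ _*_ (trans (compat-++ʳ u v (x ++ v′)) (cong (compat u v *_) (compat-++ʳ (drop (length v) u) x v′)))
                     (𝟙-× (¬? (bordered? v)) (v ≟ʷ v′)) ⟩
      compat u v * (compat (drop (length v) u) x * compat (drop (length x) (drop (length v) u)) v′) * (ub v * 𝟙 (v ≟ʷ v′))
        ≡⟨ cong (λ z → compat u v * (compat (drop (length v) u) x * compat z v′) * (ub v * 𝟙 (v ≟ʷ v′)))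
             (drop-drop (length v) (length x) u) ⟩
      compat u v * (compat (drop (length v) u) x * compat (drop p u) v′) * (ub v * 𝟙 (v ≟ʷ v′))
        ≡⟨ solve 5 (λ a b c d e → a :* (b :* c) :* (d :* e) := e :* (a :* b :* c :* d)) refl
             (compat u v) (compat (drop (length v) u) x) (compat (drop p u) v′) (ub v) (𝟙 (v ≟ʷ v′)) ⟩
      𝟙 (v ≟ʷ v′) * (compat u v * compat (drop (length v) u) x * compat (drop p u) v′ * ub v) ∎
      where
      m∸j : m ∸ length v ≡ length v + length x
      m∸j = trans (m+n∸m≡n (length v) (length x + length v)) (+-comm (length x) (length v))
    inner : ∀ v x → length v ≡ j →
      ∑ (words k j) (λ v′ → 𝟙 (v ≟ʷ v′) * (compat u v * compat (drop j u) x * compat (drop p u) v′ * ub v))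
      ≡ g v * compat (drop j u) x
    inner v x refl = trans (∑-words-pick v _)
      (solve 4 (λ a b c d → a :* b :* c :* d := a :* c :* d :* b) refl
         (compat u v) (compat (drop j u) x) (compat (drop p u) v) (ub v))
    regroup : ∀ v → length v ≡ j → g v * k ^ (r ∸ length (drop j u)) ≡ weight p j * (compat u v * ub v)
    regroup v refl = trans
      (cong₂ (λ a e → a * ub v * k ^ e) (self-overlap p v (m≤m+n j r))
             (trans (cong (r ∸_) (length-drop j u)) (∸-⊔ j r (length u))))
      (solve 4 (λ a b c d → a :* b :* c :* d := b :* d :* (a :* c)) refl
         (compat u v) (compat (drop p u) (take j u)) (ub v) (k ^ (p ∸ (j ⊔ length u))))

  bordered-rec : ∀ m → bordered m ≡ ∑< ⌊ m /2⌋ (λ i → unbordered (suc i) * weight (m ∸ suc i) (suc i))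
  bordered-rec m = begin
    bordered m
      ≡⟨ ∑-words-cong m (λ { w refl → trans (cong (compat u w *_) (bordered≡∑< w))
           (sym (*-distribˡ-∑< (compat u w) ⌊ length w /2⌋ _)) }) ⟩
    ∑ (words k m) (λ w → ∑< ⌊ m /2⌋ (λ i → compat u w * shortest w i))
      ≡⟨ ∑-∑<-swap (words k m) ⌊ m /2⌋ _ ⟩
    ∑< ⌊ m /2⌋ (λ i → ∑ (words k m) (λ w → compat u w * shortest w i))
      ≡⟨ ∑<-cong ⌊ m /2⌋ (λ i i<h → by-length i (i<⌊n/2⌋⇒2i+2≤n i<h)) ⟩
    ∑< ⌊ m /2⌋ (λ i → unbordered (suc i) * weight (m ∸ suc i) (suc i)) ∎
    where
    open ≡-Reasoning
    open +-*-Solver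
    shortest : Word k → ℕ → ℕ
    shortest w i = 𝟙 (¬? (bordered? (take (suc i) w)) ×-dec (take (suc i) w ≟ʷ drop (m ∸ suc i) w))
    by-length : ∀ i → suc i + suc i ≤ m →
      ∑ (words k m) (λ w → compat u w * shortest w i) ≡ unbordered (suc i) * weight (m ∸ suc i) (suc i)
    -- The length is rewritten as j + (r + j), the shape of `framed`, so that m - j becomes j + r.
    by-length i 2j≤m with r ← m ∸ (suc i + suc i) in eq
      with refl ← trans (sym (m∸n+n≡m 2j≤m)) (trans (cong (_+ (suc i + suc i)) eq)
             (solve 2 (λ a b → a :+ (b :+ b) := b :+ (a :+ b)) refl r (suc i))) =
      trans (framed (suc i) r) (cong (λ p → unbordered (suc i) * weight p (suc i))
        (sym (trans (m+n∸m≡n (suc i) (r + suc i)) (+-comm r (suc i)))))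

  private
    ℓ : ℕ
    ℓ = length u

  weight-zero : ∀ p → weight p 0 ≡ k ^ (p ∸ ℓ)
  weight-zero p = trans (cong (_* k ^ (p ∸ ℓ)) (compat-[]ʳ (drop p u))) (*-identityˡ _)

  private
    <length-drop : ∀ {p i} → p + i < ℓ → i < length (drop p u)
    <length-drop {p} {i} p+i<ℓ = subst (i <_) (sym (length-drop p u))
      (m+n≤o⇒m≤o∸n (suc i) (subst (_≤ ℓ) (cong suc (+-comm p i)) p+i<ℓ))

    exponent-zero : ∀ {p i j} → p + i < ℓ → p ∸ (j ⊔ ℓ) ≡ 0
    exponent-zero {p} {i} {j} p+i<ℓ =
      m≤n⇒m∸n≡0 (≤-trans (≤-trans (m≤m+n p i) (<⇒≤ p+i<ℓ)) (m≤n⊔m j ℓ))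

  -- From p + i < |u| it follows that p < |u|, so the exponent of k is 0 on both sides and only the
  -- compared letters matter.
  weight-match : ∀ p i → p + i < ℓ → letterAt u (p + i) ≡ letterAt u i → weight p (suc i) ≡ weight p i
  weight-match p i p+i<ℓ eq = cong₂ (λ a e → a * k ^ e)
    (compat-take-match i (drop p u) u (<length-drop p+i<ℓ) (≤-<-trans (m≤n+m i p) p+i<ℓ)
      (trans (letterAt-drop p u i) eq))
    (trans (exponent-zero {j = suc i} p+i<ℓ) (sym (exponent-zero {j = i} p+i<ℓ)))

  weight-mismatch : ∀ p i → p + i < ℓ → letterAt u (p + i) ≢ letterAt u i → weight p (suc i) ≡ 0
  weight-mismatch p i p+i<ℓ neq = cong (_* k ^ (p ∸ (suc i ⊔ ℓ)))
    (compat-take-mismatch i (drop p u) u (<length-drop p+i<ℓ) (≤-<-trans (m≤n+m i p) p+i<ℓ)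
      (λ eq → neq (trans (sym (letterAt-drop p u i)) eq)))

  private
    length-drop≤ : ∀ {p i} → ℓ ≤ p + i → length (drop p u) ≤ i
    length-drop≤ {p} ℓ≤p+i = ≤-trans (≤-reflexive (length-drop p u)) (m≤n+o⇒m∸n≤o ℓ p ℓ≤p+i)

  -- `drop p u` has at most i letters, so the next letter of `u` meets no constraint, and the
  -- maximum in the exponent is still |u|.
  weight-free : ∀ p i → ℓ ≤ p + i → i < ℓ → weight p (suc i) ≡ weight p i
  weight-free p i ℓ≤p+i i<ℓ = cong₂ (λ a e → a * k ^ (p ∸ e))
    (compat-take-long i (drop p u) u (length-drop≤ ℓ≤p+i))
    (trans (m≤n⇒m⊔n≡n i<ℓ) (sym (m≤n⇒m⊔n≡n (<⇒≤ i<ℓ))))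

  -- Past |u|, a border longer by one letter leaves one free letter fewer. The product form is what
  -- makes the machine's division exact; `i < p` keeps the exponent on the left positive.
  weight-divide : ∀ p i → ℓ ≤ i → i < p → weight p i ≡ weight p (suc i) * k
  weight-divide p i ℓ≤i i<p = begin
    compat (drop p u) (take i u) * k ^ (p ∸ (i ⊔ ℓ))
      ≡⟨ cong₂ (λ a e → a * k ^ e)
           (sym (compat-take-long i (drop p u) u (length-drop≤ (≤-trans ℓ≤i (m≤n+m i p)))))
           (trans (cong (p ∸_) (m≥n⇒m⊔n≡m ℓ≤i))
             (trans (+-∸-assoc 1 i<p) (cong (λ e → suc (p ∸ e)) (sym (m≥n⇒m⊔n≡m (m≤n⇒m≤1+n ℓ≤i)))))) ⟩
    compat (drop p u) (take (suc i) u) * (k * k ^ (p ∸ (suc i ⊔ ℓ)))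
      ≡⟨ solve 3 (λ a b c → a :* (b :* c) := a :* c :* b) refl
           (compat (drop p u) (take (suc i) u)) k (k ^ (p ∸ (suc i ⊔ ℓ))) ⟩
    weight p (suc i) * k ∎
    where
    open ≡-Reasoning
    open +-*-Solver

-- Structured programs

open import Data.Integer.Base using (+_)

infixr 4 _⨾_

-- Every construct carries the command that follows it, so sequencing needs no rule of its own. Both
-- `while` and `ifpos` test whether the register is positive.
data Cmd : Set where
  done  : Cmd
  _⨾_   : Instr → Cmd → Cmd
  while : Register → Cmd → Cmd → Cmd
  ifpos : Register → Cmd → Cmd → Cmd → Cmd

end : Cmd → Label → Label
end done              ℓ = ℓ
end (i ⨾ c)           ℓ = end c (suc ℓ)
end (while r b c)     ℓ = end c (suc (end b (2 + ℓ)))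
end (ifpos r b₁ b₂ c) ℓ = end c (end b₁ (suc (end b₂ (suc ℓ))))

-- compile c ℓ K is the code of c placed at address ℓ and followed by K.
compile : Cmd → Label → Program → Program
compile done              ℓ K = K
compile (i ⨾ c)           ℓ K = i ∷ compile c (suc ℓ) K
compile (while r b c)     ℓ K =
  jpos r (2 + ℓ) ∷ jump (suc (end b (2 + ℓ))) ∷ compile b (2 + ℓ)
  (jump ℓ ∷ compile c (suc (end b (2 + ℓ))) K)
compile (ifpos r b₁ b₂ c) ℓ K =
  jpos r (suc (end b₂ (suc ℓ))) ∷ compile b₂ (suc ℓ)
  (jump (end b₁ (suc (end b₂ (suc ℓ)))) ∷ compile b₁ (suc (end b₂ (suc ℓ)))
  (compile c (end b₁ (suc (end b₂ (suc ℓ)))) K))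

-- Refers to the whole program and absolute addresses only, so a command can be run without
-- mentioning the code around it.
Loaded : Program → Cmd → Label → Set
Loaded P done              ℓ = ⊤
Loaded P (i ⨾ c)           ℓ = P ‼ ℓ ≡ just i × Loaded P c (suc ℓ)
Loaded P (while r b c)     ℓ =
  P ‼ ℓ ≡ just (jpos r (2 + ℓ)) × P ‼ suc ℓ ≡ just (jump (suc (end b (2 + ℓ)))) ×
  Loaded P b (2 + ℓ) × P ‼ end b (2 + ℓ) ≡ just (jump ℓ) × Loaded P c (suc (end b (2 + ℓ)))
Loaded P (ifpos r b₁ b₂ c) ℓ =
  P ‼ ℓ ≡ just (jpos r (suc (end b₂ (suc ℓ)))) × Loaded P b₂ (suc ℓ) ×
  P ‼ end b₂ (suc ℓ) ≡ just (jump (end b₁ (suc (end b₂ (suc ℓ))))) ×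
  Loaded P b₁ (suc (end b₂ (suc ℓ))) × Loaded P c (end b₁ (suc (end b₂ (suc ℓ))))

drop-tail : ∀ {A : Set} ℓ (P : List A) {x Q} → drop ℓ P ≡ x ∷ Q → drop (suc ℓ) P ≡ Q
drop-tail zero    (_ ∷ P) refl = refl
drop-tail (suc ℓ) (_ ∷ P) eq   = drop-tail ℓ P eq

loaded : ∀ P c ℓ {K} → drop ℓ P ≡ compile c ℓ K → Loaded P c ℓ × drop (end c ℓ) P ≡ K
loaded P done    ℓ eq = tt , eq
loaded P (i ⨾ c) ℓ eq with lc , eq′ ← loaded P c (suc ℓ) (drop-tail ℓ P eq) = (cong head eq , lc) , eq′
loaded P (while r b c) ℓ eq
  with eq₁ ← drop-tail ℓ P eq
  with lb , eq₂ ← loaded P b (2 + ℓ) (drop-tail (suc ℓ) P eq₁)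
  with lc , eq₃ ← loaded P c _ (drop-tail (end b (2 + ℓ)) P eq₂) =
  (cong head eq , cong head eq₁ , lb , cong head eq₂ , lc) , eq₃
loaded P (ifpos r b₁ b₂ c) ℓ eq
  with lb₂ , eq₁ ← loaded P b₂ (suc ℓ) (drop-tail ℓ P eq)
  with lb₁ , eq₂ ← loaded P b₁ _ (drop-tail (end b₂ (suc ℓ)) P eq₁)
  with lc , eq₃ ← loaded P c _ eq₂ =
  (cong head eq , lb₂ , cong head eq₁ , lb₁ , lc) , eq₃

-- Exactly the instructions that fall through to the next address; jumps arise only from compiling
-- `while` and `ifpos`.
data Effect : Instr → Memory → List Register → Memory → Set where
  const : ∀ {m d c} → Effect (const d c) m (d ∷ []) (m [ d ↦ c ])
  move  : ∀ {m d a} → Effect (move d a) m (d ∷ a ∷ []) (m [ d ↦ m a ])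
  arith : ∀ {m op d a b} → Effect (arith op d a b) m (d ∷ a ∷ b ∷ []) (m [ d ↦ ⟦ op ⟧ (m a) (m b) ])
  div   : ∀ {m d a b} .{{_ : ℤ.NonZero (m b)}} → Effect (div d a b) m (d ∷ a ∷ b ∷ []) (m [ d ↦ m a ℤ./ m b ])
  load  : ∀ {m d a i} → m a ≡ + i → Effect (load d a) m (d ∷ a ∷ i ∷ []) (m [ d ↦ m i ])
  store : ∀ {m a b i} → m a ≡ + i → Effect (store a b) m (a ∷ b ∷ i ∷ []) (m [ i ↦ m b ])

effect-step : ∀ {P ℓ i m rs m′} → P ‼ ℓ ≡ just i → Effect i m rs m′ → P ⊢ (ℓ , m) ⟶[ rs ] (suc ℓ , m′)
effect-step eq const      = const eq
effect-step eq move       = move eq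
effect-step eq arith      = arith eq
effect-step eq div        = div eq
effect-step eq (load ad)  = load eq ad
effect-step eq (store ad) = store eq ad

-- A Hoare logic with time and space bounds.

module Hoare (s : ℕ) where

  -- A partial run is represented by what it does to every halting run that continues it.
  Reaches : Program → Config → ℕ → Label → (Memory → Set) → Set
  Reaches P γ T ℓ Q = ∃[ t ] ∃[ m ] t ≤ T × Q m ×
    (∀ {t′ m′} → P ⊢ (ℓ , m) ⇓⟨ t′ , s ⟩ m′ → P ⊢ γ ⇓⟨ t + t′ , s ⟩ m′)

  record Achieves (c : Cmd) (m : Memory) (T : ℕ) (Q : Memory → Set) : Set where
    constructor achieves
    field run : ∀ P ℓ → Loaded P c ℓ → Reaches P (ℓ , m) T (end c ℓ) Q
  open Achieves public

  private variable
    P : Program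
    γ γ′ : Config
    ℓ : Label
    m : Memory
    Q R : Memory → Set
    c b₁ b₂ : Cmd
    r t T₁ T₂ : ℕ

  reaches-step : ∀ {rs} → P ⊢ γ ⟶[ rs ] γ′ → All (_< s) rs → Reaches P γ′ t ℓ Q → Reaches P γ (suc t) ℓ Q
  reaches-step st rs<s (t , m , t≤ , q , k) = suc t , m , s≤s t≤ , q , λ h → step st rs<s (k h)

  reaches-trans : ∀ {ℓ₁ ℓ₂} → Reaches P γ T₁ ℓ₁ R →
    (∀ m → R m → Reaches P (ℓ₁ , m) T₂ ℓ₂ Q) → Reaches P γ (T₁ + T₂) ℓ₂ Q
  reaches-trans {P = P} {γ = γ} (t₁ , m₁ , t₁≤ , r , k₁) next with next m₁ r
  ... | t₂ , m₂ , t₂≤ , q , k₂ = t₁ + t₂ , m₂ , +-mono-≤ t₁≤ t₂≤ , q ,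
    λ {t′} {m′} h → subst (λ t → P ⊢ γ ⇓⟨ t , s ⟩ m′) (sym (+-assoc t₁ t₂ t′)) (k₁ (k₂ h))

  reaches-weaken : T₁ ≤ T₂ → Reaches P γ T₁ ℓ Q → Reaches P γ T₂ ℓ Q
  reaches-weaken le (t , m , t≤ , rest) = t , m , ≤-trans t≤ le , rest

  weaken : T₁ ≤ T₂ → Achieves c m T₁ Q → Achieves c m T₂ Q
  run (weaken le ac) P ℓ lc = reaches-weaken le (run ac P ℓ lc)

  achieves-done : Q m → Achieves done m t Q
  run (achieves-done q) P ℓ _ = 0 , _ , z≤n , q , id

  achieves-⨾ : ∀ {i rs m′} → Effect i m rs m′ → All (_< s) rs → Achieves c m′ t Q → Achieves (i ⨾ c) m (suc t) Q
  run (achieves-⨾ ef rs<s ac) P ℓ (eq , lc) = reaches-step (effect-step eq ef) rs<s (run ac P (suc ℓ) lc)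

  -- The 2 pays for the test and for the jump that ends the negative branch; the positive branch is
  -- placed last and saves this jump.
  achieves-ifpos : ∀ T₁ T₂ → r < s → (0ℤ ℤ.< m r → Achieves b₁ m T₁ R) → (¬ (0ℤ ℤ.< m r) → Achieves b₂ m T₁ R) →
    (∀ m′ → R m′ → Achieves c m′ T₂ Q) → Achieves (ifpos r b₁ b₂ c) m (2 + T₁ + T₂) Q
  run (achieves-ifpos {r = r} {m = m} {b₁ = b₁} {b₂ = b₂} T₁ T₂ r<s pos neg next) P ℓ (j , l₂ , j′ , l₁ , lc)
    with 0ℤ ℤ.<? m r
  ... | yes p = reaches-step (jpos-taken j p) (r<s ∷ []) (reaches-weaken (n≤1+n (T₁ + T₂))
    (reaches-trans (run (pos p) P _ l₁) λ m′ q → run (next m′ q) P _ lc))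
  ... | no ¬p = reaches-step (jpos-not-taken j ¬p) (r<s ∷ []) (reaches-weaken (≤-reflexive (+-suc T₁ T₂))
    (reaches-trans (run (neg ¬p) P _ l₂) λ m′ q → reaches-step (jump j′) [] (run (next m′ q) P _ lc)))

  -- The invariant is indexed by the iteration count. An iteration pays 2 for its test and the jump
  -- back, the exit 2 for the failed test and the jump out.
  achieves-while : (I : ℕ → Memory → Set) (N T₁ T₂ : ℕ) → r < s →
    (∀ i m → i < N → I i m → (0ℤ ℤ.< m r) × Achieves b₁ m T₁ (I (suc i))) →
    (∀ m → I N m → ¬ (0ℤ ℤ.< m r)) →
    I 0 m → (∀ m′ → I N m′ → Achieves c m′ T₂ Q) →
    Achieves (while r b₁ c) m (N * (2 + T₁) + (2 + T₂)) Q
  run (achieves-while {r = r} {b₁ = b₁} {c = c} {Q = Q} I N T₁ T₂ r<s body stop start next) P ℓ (j , j₁ , lb , j₂ , lc) =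
    loop N 0 (+-identityʳ N) _ start
    where
    loop : ∀ d i → d + i ≡ N → ∀ m → I i m → Reaches P (ℓ , m) (d * (2 + T₁) + (2 + T₂)) (end (while r b₁ c) ℓ) Q
    loop zero i refl m inv =
      reaches-step (jpos-not-taken j (stop m inv)) (r<s ∷ []) (reaches-step (jump j₁) [] (run (next m inv) P _ lc))
    loop (suc d) i eq m inv with body i m (subst (i <_) eq (s≤s (m≤n+m i d))) inv
    ... | pos , ac = reaches-step (jpos-taken j pos) (r<s ∷ [])
      (reaches-weaken (≤-reflexive rearrange)
        (reaches-trans (run ac P _ lb) λ m′ inv′ →
          reaches-step (jump j₂) [] (loop d (suc i) (trans (+-suc d i) eq) m′ inv′)))
      where
      rearrange : T₁ + suc (d * (2 + T₁) + (2 + T₂)) ≡ suc (T₁ + d * (2 + T₁) + (2 + T₂))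
      rearrange = trans (+-suc T₁ _) (cong suc (sym (+-assoc T₁ (d * (2 + T₁)) (2 + T₂))))

  achieves⇒halts : ∀ c m T Q → Achieves c m T Q → let P = compile c 0 (halt ∷ []) in
    ∃[ t ] ∃[ m′ ] t ≤ T + 1 × Q m′ × P ⊢ (0 , m) ⇓⟨ t , s ⟩ m′
  achieves⇒halts c m T Q ac with lc , eq ← loaded (compile c 0 (halt ∷ [])) c 0 refl
    with t , m′ , t≤ , q , k ← run ac _ 0 lc =
    t + 1 , m′ , +-monoˡ-≤ 1 t≤ , q , k (halt (cong head eq))

-- The algorithm

lookup-same : ∀ (m : Memory) r v → (m [ r ↦ v ]) r ≡ v
lookup-same m r v = cong (λ b → if b then v else m r) (dec-true (r ≟ r) refl)

lookup-other : ∀ (m : Memory) {r r′} v → r′ ≢ r → (m [ r ↦ v ]) r′ ≡ m r′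
lookup-other m {r} {r′} v neq = cong (λ b → if b then v else m r′) (dec-false (r′ ≟ r) neq)

-- Counters such as |u| - a run below zero, so they are kept as integer differences and not as
-- truncated ones; this is their decrement.
sub-suc : ∀ c b → (+ c ℤ.- + b) ℤ.- + 1 ≡ + c ℤ.- + suc b
sub-suc c b = trans (ℤ.+-assoc (+ c) (ℤ.- + b) (ℤ.- + 1)) (cong (λ x → + c ℤ.+ x)
  (trans (sym (ℤ.neg-distrib-+ (+ b) (+ 1))) (cong (λ x → ℤ.- + x) (+-comm b 1))))

sub-≥ : ∀ {c b} → b ≤ c → + c ℤ.- + b ≡ + (c ∸ b)
sub-≥ {c} {b} b≤c = trans (ℤ.m-n≡m⊖n c b) (ℤ.⊖-≥ b≤c)

sub-pos : ∀ {c b} → b < c → 0ℤ ℤ.< + c ℤ.- + b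
sub-pos b<c = subst (0ℤ ℤ.<_) (sym (sub-≥ (<⇒≤ b<c))) (ℤ.+<+ (m<n⇒0<n∸m b<c))

sub-nonpos : ∀ {c b} → c ≤ b → ¬ (0ℤ ℤ.< + c ℤ.- + b)
sub-nonpos c≤b = ℤ.≤⇒≯ (ℤ.i≤j⇒i-j≤0 (ℤ.+≤+ c≤b))

sub-pos⁻¹ : ∀ {c b} → 0ℤ ℤ.< + c ℤ.- + b → b < c
sub-pos⁻¹ p = ≰⇒> λ c≤b → sub-nonpos c≤b p

sub-nonpos⁻¹ : ∀ {c b} → ¬ (0ℤ ℤ.< + c ℤ.- + b) → c ≤ b
sub-nonpos⁻¹ p = ≮⇒≥ λ b<c → p (sub-pos b<c)

div-exact : ∀ {x y} .{{_ : ℤ.NonZero y}} a k → x ≡ + (a * k) → y ≡ + k → x ℤ./ y ≡ + a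
div-exact a k@(suc _) refl refl = trans (ℤ.div-pos-is-/ℕ (+ (a * k)) k) (cong +_ (ℕ.m*n/n≡m a k))

-- Lets a test for positivity decide whether two letters differ, whichever is larger.
square-pos : ∀ i → i ≢ 0ℤ → 0ℤ ℤ.< i ℤ.* i
square-pos (+ zero)     i≢0 = contradiction refl i≢0
square-pos (+ suc n)    i≢0 = ℤ.+<+ z<s
square-pos (ℤ.-[1+ n ]) i≢0 = ℤ.+<+ z<s

-- Boolean, so that for literal registers and for addresses of the form 64 + x the side condition is
-- settled by evaluation.
outside : ℕ → ℕ → Register → Bool
outside lo hi r = (r <ᵇ lo) ∨ (hi <ᵇ r)

record Agree (lo hi : ℕ) (m m′ : Memory) : Set where
  constructor agree
  field at : ∀ r {_ : T (outside lo hi r)} → m′ r ≡ m r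
open Agree

agree-refl : ∀ {lo hi m} → Agree lo hi m m
agree-refl = agree λ _ → refl

agree-update : ∀ {lo hi m m′} d v → outside lo hi d ≡ false → Agree lo hi m m′ → Agree lo hi m (m′ [ d ↦ v ])
agree-update {m′ = m′} d v inside a = agree λ r {out} →
  trans (lookup-other m′ v λ { refl → subst T inside out }) (at a r {out})

-- R₀ is the target address, R₄ the source address, R₅ the count of letters left and R₆ the letter
-- in transit.
copyBody : Cmd
copyBody = load 6 4 ⨾ store 0 6 ⨾ arith add 0 3 0 ⨾ arith add 4 7 4 ⨾ arith sub 5 5 7 ⨾ done

-- In iteration a of the outer loop (words of length a + 1) and iteration b of the
-- inner one (shortest borders of length b + 1), and with base as defined below:
--   R₀ = n - a     R₁ = k     R₂ = |u|     R₃ = 3     R₇ = 1     R₈ = base 0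
--   R₉ = base a    R₁₀ = k^(a + 1 ∸ |u|)   R₁₁ = |u| - a   R₁₂ = partial sum of Bd(a + 1)
--   R₁₃ = base b   R₁₄ = base (a - b)      R₁₅ = a - 2b    R₁₆ = |u| - b   R₁₇ = a
updateWeight : Cmd → Cmd
updateWeight = ifpos 11
  (load 20 9 ⨾ load 21 13 ⨾ arith sub 20 20 21 ⨾ arith mul 20 20 20 ⨾
   ifpos 20 (const 19 0ℤ ⨾ done) done done)
  (ifpos 16 done (div 19 19 1 ⨾ done) done)

-- R₁₈ is the address of the weight for p = a - b, and R₂₀ ends as the address of U(b + 1). R₁₅
-- drops by 2 because 2(b + 1) ≤ a + 1 is the same as a - 2b > 0.
innerBody : Cmd
innerBody =
  arith sub 14 14 3 ⨾ arith add 18 7 14 ⨾ load 19 18 ⨾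
  updateWeight
  (store 18 19 ⨾
  arith add 20 7 13 ⨾ arith add 20 7 20 ⨾ load 21 20 ⨾ arith mul 21 21 19 ⨾ arith add 12 12 21 ⨾
  arith add 13 3 13 ⨾ arith sub 15 15 7 ⨾ arith sub 15 15 7 ⨾ arith sub 16 16 7 ⨾ done)

outerBody : Cmd
outerBody =
  ifpos 11 done (arith mul 10 10 1 ⨾ done)
  (const 12 0ℤ ⨾ move 13 8 ⨾ move 14 9 ⨾ move 15 17 ⨾ move 16 2 ⨾
  while 15 innerBody
  (arith add 18 7 9 ⨾ store 18 10 ⨾
  arith add 18 7 18 ⨾ arith sub 19 10 12 ⨾ store 18 19 ⨾
  arith add 9 3 9 ⨾ arith sub 11 11 7 ⨾ arith add 17 7 17 ⨾ arith sub 0 0 7 ⨾ done))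

copyLetters : Cmd → Cmd
copyLetters c =
  store 0 4 ⨾ arith add 0 3 0 ⨾ store 0 5 ⨾ arith add 0 3 0 ⨾ store 0 6 ⨾ arith add 0 3 0 ⨾
  store 0 7 ⨾ arith add 0 3 0 ⨾ store 0 8 ⨾ arith add 0 3 0 ⨾
  -- Six letters are saved, so R₀ is `base 6`, and subtracting 6 * 3 gives `base 0`. The next
  -- letter, of index 6, is in R₉.
  const 4 (+ 18) ⨾ arith sub 8 0 4 ⨾ const 4 (+ 9) ⨾ const 5 (+ 6) ⨾ arith sub 5 2 5 ⨾ const 7 (+ 1) ⨾
  while 5 copyBody c

-- The input may occupy all registers from R₃ on, so the first scratch
-- registers are freed by storing letters at addresses computed in R₀ alone.
relocate : Cmd → Cmd
relocate c =
  arith add 0 0 0 ⨾ arith add 0 0 0 ⨾ arith add 0 0 0 ⨾ arith add 0 0 0 ⨾ arith add 0 0 0 ⨾ arith add 0 0 0 ⨾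
  store 0 3 ⨾ const 3 (+ 3) ⨾ arith add 0 3 0 ⨾
  copyLetters (const 4 (+ 64) ⨾ div 0 8 4 ⨾ c)

main : Cmd
main =
  move 9 8 ⨾ const 10 (+ 1) ⨾ move 11 2 ⨾ const 12 0ℤ ⨾ const 17 0ℤ ⨾
  while 0 outerBody
  (move 0 12 ⨾ done)

countBordered : Program
countBordered = compile (relocate main) 0 (halt ∷ [])

-- Nested as the rules add up their costs: 7 = 2 + 5 per letter copied by the loop, 24 = 2 + 22 per
-- border length, and at most n border lengths for each word length.
timeBound : ℕ → ℕ → ℕ
timeBound l n = 25 + (l * 7 + (2 + (2 + (5 + (n * (2 + (19 + n * 24)) + (2 + 1)))))) + 1

timeBound-quadratic : ∀ l n → 1 ≤ n → l ≤ n → timeBound l n ≤ 90 * n ^ 2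
timeBound-quadratic l n 1≤n l≤n = begin
  25 + (l * 7 + (2 + (2 + (5 + (n * (2 + (19 + n * 24)) + (2 + 1)))))) + 1
    ≡⟨ solve 2 (λ x y → con 25 :+ (x :* con 7 :+ (con 2 :+ (con 2 :+ (con 5 :+ (y :* (con 2 :+ (con 19 :+ y :* con 24)) :+ (con 2 :+ con 1))))))
         :+ con 1 := con 38 :+ x :* con 7 :+ y :* con 21 :+ y :* y :* con 24) refl l n ⟩
  38 + l * 7 + n * 21 + n * n * 24
    ≤⟨ +-monoˡ-≤ (n * n * 24) (+-mono-≤ (+-mono-≤ (*-monoˡ-≤ 38 1≤n²) (*-monoˡ-≤ 7 (≤-trans l≤n n≤n²))) (*-monoˡ-≤ 21 n≤n²)) ⟩
  n * n * 38 + n * n * 7 + n * n * 21 + n * n * 24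
    ≡⟨ solve 1 (λ z → z :* con 38 :+ z :* con 7 :+ z :* con 21 :+ z :* con 24 := z :* con 90) refl (n * n) ⟩
  n * n * 90
    ≡⟨ *-comm (n * n) 90 ⟩
  90 * (n * n)
    ≡⟨ cong (λ x → 90 * (n * x)) (*-identityʳ n) ⟨
  90 * n ^ 2 ∎
  where
  open ≤-Reasoning
  open +-*-Solver
  1≤n² : 1 ≤ n * n
  1≤n² = *-mono-≤ 1≤n 1≤n
  n≤n² : n ≤ n * n
  n≤n² = m≤m*n n n {{>-nonZero 1≤n}}

-- Correctness of the machine program.

module Correctness (n′ k : ℕ) .{{_ : NonZero k}} (u : Word k) (u≤n : length u ≤ suc n′) where

  open Recurrence u

  n ℓ : ℕ
  n = suc n′
  ℓ = length u

  -- Three interleaved arrays: the letter u_i is kept at base i, W(i + 1, -) at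
  -- base i + 1 and U(i + 1) at base i + 2.  The leading 64 lets comparisons of these
  -- addresses with the directly addressed registers be decided by computation.
  base : ℕ → ℕ
  base i = 64 + (i * 3 + n′ * 64)

  -- The margin beyond n makes room for the six letter cells that are written even if n is smaller
  -- than 6.
  space : ℕ
  space = base (n + 7)

  open Hoare space

  lit : ∀ r {_ : T (r <ᵇ 64)} → r < space
  lit r {p} = ≤-trans (<ᵇ⇒< r 64 p) (m≤m+n 64 _)

  base-mono : ∀ {i j} → i ≤ j → base i ≤ base j
  base-mono i≤j = +-monoʳ-≤ 64 (+-monoˡ-≤ (n′ * 64) (*-monoˡ-≤ 3 i≤j))

  2+base<space : ∀ {i} → i < n + 7 → 2 + base i < space
  2+base<space = base-mono

  1+base<space : ∀ {i} → i < n + 7 → 1 + base i < space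
  1+base<space i< = <-trans (n<1+n _) (2+base<space i<)

  base<space : ∀ {i} → i < n + 7 → base i < space
  base<space i< = <-trans (n<1+n _) (1+base<space i<)

  base-injective : ∀ i j → base i ≡ base j → i ≡ j
  base-injective i j eq = *-cancelʳ-≡ i j 3 (+-cancelʳ-≡ (n′ * 64) (i * 3) (j * 3) (+-cancelˡ-≡ 64 _ _ eq))

  3i≢1+3j : ∀ i j → i * 3 ≢ 1 + j * 3
  3i≢1+3j (suc i) (suc j) eq = 3i≢1+3j i j (+-cancelˡ-≡ 3 _ _ eq)

  3i≢2+3j : ∀ i j → i * 3 ≢ 2 + j * 3
  3i≢2+3j (suc i) (suc j) eq = 3i≢2+3j i j (+-cancelˡ-≡ 3 _ _ eq)

  base≢1+base : ∀ i j → base i ≢ 1 + base j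
  base≢1+base i j eq = 3i≢1+3j i j (+-cancelʳ-≡ (n′ * 64) (i * 3) (1 + j * 3) (+-cancelˡ-≡ 64 _ _ eq))

  base≢2+base : ∀ i j → base i ≢ 2 + base j
  base≢2+base i j eq = 3i≢2+3j i j (+-cancelʳ-≡ (n′ * 64) (i * 3) (2 + j * 3) (+-cancelˡ-≡ 64 _ _ eq))

  private variable
    m : Memory
    Q : Memory → Set
    c : Cmd
    t : ℕ

  run-const : ∀ {d v} {_ : T (d <ᵇ 64)} → Achieves c (m [ d ↦ v ]) t Q → Achieves (const d v ⨾ c) m (suc t) Q
  run-const {d = d} {_} {p} = achieves-⨾ const (lit d {p} ∷ [])

  -- The written value is given up to _≡_: iterating m [ d ↦ ⟦ op ⟧ (m a) (m b) ] would
  -- produce memory terms of exponential size.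
  run-move : ∀ {d a v} {_ : T (d <ᵇ 64)} {_ : T (a <ᵇ 64)} → m a ≡ v →
    Achieves c (m [ d ↦ v ]) t Q → Achieves (move d a ⨾ c) m (suc t) Q
  run-move {d = d} {a} {_} {p} {q} refl = achieves-⨾ move (lit d {p} ∷ lit a {q} ∷ [])

  run-arith : ∀ {op d a b v} {_ : T (d <ᵇ 64)} {_ : T (a <ᵇ 64)} {_ : T (b <ᵇ 64)} → ⟦ op ⟧ (m a) (m b) ≡ v →
    Achieves c (m [ d ↦ v ]) t Q → Achieves (arith op d a b ⨾ c) m (suc t) Q
  run-arith {d = d} {a} {b} {_} {p} {q} {r} refl = achieves-⨾ arith (lit d {p} ∷ lit a {q} ∷ lit b {r} ∷ [])

  run-div : ∀ {d a b v} {_ : T (d <ᵇ 64)} {_ : T (a <ᵇ 64)} {_ : T (b <ᵇ 64)} .{{_ : ℤ.NonZero (m b)}} →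
    m a ℤ./ m b ≡ v → Achieves c (m [ d ↦ v ]) t Q → Achieves (div d a b ⨾ c) m (suc t) Q
  run-div {d = d} {a} {b} {_} {p} {q} {r} refl = achieves-⨾ div (lit d {p} ∷ lit a {q} ∷ lit b {r} ∷ [])

  run-load : ∀ {d a v} i {_ : T (d <ᵇ 64)} {_ : T (a <ᵇ 64)} → m a ≡ + i → i < space → m i ≡ v →
    Achieves c (m [ d ↦ v ]) t Q → Achieves (load d a ⨾ c) m (suc t) Q
  run-load {d = d} {a} i {p} {q} eq i<s refl = achieves-⨾ (load eq) (lit d {p} ∷ lit a {q} ∷ i<s ∷ [])

  run-store : ∀ {a b v} i {_ : T (a <ᵇ 64)} {_ : T (b <ᵇ 64)} → m a ≡ + i → i < space → m b ≡ v →
    Achieves c (m [ i ↦ v ]) t Q → Achieves (store a b ⨾ c) m (suc t) Q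
  run-store {a = a} {b} i {p} {q} eq i<s refl = achieves-⨾ (store eq) (lit a {p} ∷ lit b {q} ∷ i<s ∷ [])

  -- Invariants and bodies of the two main loops.

  record Frame (m : Memory) : Set where
    field
      r1 : m 1 ≡ + k
      r2 : m 2 ≡ + ℓ
      r3 : m 3 ≡ + 3
      r7 : m 7 ≡ + 1
      r8 : m 8 ≡ + base 0
      letters : ∀ i → i < ℓ → m (base i) ≡ letterAt u i

  summand : ℕ → ℕ → ℕ
  summand a i = unbordered (suc i) * weight (a ∸ i) (suc i)

  -- The cell of p = q + 1 is touched only in iteration i = a - p, which takes it from W(p, i) to
  -- W(p, i + 1): `fresh` describes the cells already advanced, `stale` those still waiting. Cells
  -- with i > p carry no claim, as no later summand reads them. Differences are stated as sums to
  -- avoid truncated subtraction.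
  record Inner (a b : ℕ) (m : Memory) : Set where
    field
      frame : Frame m
      r0  : m 0 ≡ + n ℤ.- + a
      r9  : m 9 ≡ + base a
      r10 : m 10 ≡ + (k ^ (suc a ∸ ℓ))
      r11 : m 11 ≡ + ℓ ℤ.- + a
      r12 : m 12 ≡ + ∑< b (summand a)
      r13 : m 13 ≡ + base b
      r14 : ∀ p → p + b ≡ a → m 14 ≡ + base p
      r15 : m 15 ≡ + a ℤ.- + (b + b)
      r16 : m 16 ≡ + ℓ ℤ.- + b
      r17 : m 17 ≡ + a
      fresh : ∀ q i → suc q + i ≡ a → i < b → m (suc (base q)) ≡ + weight (suc q) (suc i)
      stale : ∀ q i → suc q + i ≡ a → b ≤ i → i ≤ suc q → m (suc (base q)) ≡ + weight (suc q) i
      unborders : ∀ i → i < a → m (2 + base i) ≡ + unbordered (suc i)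

  -- Three cases, with p = q + 1: for p + b < |u| two letters of `u` are compared; for b < |u| ≤ p +
  -- b nothing changes; for |u| ≤ b one free letter is divided out.
  update-weight : ∀ q b → suc q + b < n → b < suc q →
    m 1 ≡ + k → (∀ i → i < ℓ → m (base i) ≡ letterAt u i) →
    m 9 ≡ + base (suc q + b) → m 11 ≡ + ℓ ℤ.- + (suc q + b) → m 13 ≡ + base b → m 16 ≡ + ℓ ℤ.- + b →
    m 19 ≡ + weight (suc q) b →
    (∀ m′ → m′ 19 ≡ + weight (suc q) (suc b) × Agree 19 21 m m′ → Achieves c m′ t Q) →
    Achieves (updateWeight c) m (9 + t) Q
  update-weight {m = m} {c = c} {t = t} {Q = Q} q b a<n b<p r1 letters r9 r11 r13 r16 r19 =
    achieves-ifpos 7 t (lit 11) inside beyond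
    where
    a : ℕ
    a = suc q + b
    R : Memory → Set
    R m′ = m′ 19 ≡ + weight (suc q) (suc b) × Agree 19 21 m m′
    inside : 0ℤ ℤ.< m 11 → Achieves _ m 7 R
    inside pos =
      run-load (base a) r9 (base<space (m≤n⇒m≤n+o 7 a<n)) refl $
      run-load (base b) r13 (base<space (m≤n⇒m≤n+o 7 (≤-<-trans (m≤n+m b (suc q)) a<n))) refl $
      run-arith refl $ run-arith refl $ achieves-ifpos 1 0 (lit 20) mismatch match λ _ → achieves-done
      where
      a<ℓ : a < ℓ
      a<ℓ = sub-pos⁻¹ (subst (0ℤ ℤ.<_) r11 pos)
      x y : ℤ
      x = m (base a)
      y = m (base b)
      x≡ : x ≡ letterAt u a
      x≡ = letters a a<ℓ
      y≡ : y ≡ letterAt u b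
      y≡ = letters b (≤-<-trans (m≤n+m b (suc q)) a<ℓ)
      m₄ : Memory
      m₄ = (((m [ 20 ↦ x ]) [ 21 ↦ y ]) [ 20 ↦ x ℤ.- y ]) [ 20 ↦ (x ℤ.- y) ℤ.* (x ℤ.- y) ]
      ag : Agree 19 21 m m₄
      ag = agree-update 20 _ refl (agree-update 20 _ refl (agree-update 21 _ refl (agree-update 20 _ refl agree-refl)))
      mismatch : 0ℤ ℤ.< (x ℤ.- y) ℤ.* (x ℤ.- y) → Achieves _ m₄ 1 R
      mismatch pos = run-const (achieves-done
        ( sym (cong +_ (weight-mismatch (suc q) b a<ℓ λ eq →
            ℤ.<-irrefl refl (subst (λ d → 0ℤ ℤ.< d ℤ.* d) (ℤ.i≡j⇒i-j≡0 (trans x≡ (trans eq (sym y≡)))) pos)))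
        , agree-update 19 _ refl ag))
      match : ¬ (0ℤ ℤ.< (x ℤ.- y) ℤ.* (x ℤ.- y)) → Achieves _ m₄ 1 R
      match ¬pos = achieves-done (trans r19 (sym (cong +_ (weight-match (suc q) b a<ℓ eq))) , ag)
        where
        eq : letterAt u a ≡ letterAt u b
        eq with x ℤ.- y ℤ.≟ 0ℤ
        ... | yes x-y≡0 = trans (sym x≡) (trans (ℤ.i-j≡0⇒i≡j x y x-y≡0) y≡)
        ... | no  x-y≢0 = contradiction (square-pos _ x-y≢0) ¬pos
    beyond : ¬ (0ℤ ℤ.< m 11) → Achieves _ m 7 R
    beyond ¬pos = weaken (s≤s (s≤s (s≤s z≤n))) (achieves-ifpos 1 0 (lit 16) free shrink λ _ → achieves-done)
      where
      ℓ≤a : ℓ ≤ a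
      ℓ≤a = sub-nonpos⁻¹ (λ p → ¬pos (subst (0ℤ ℤ.<_) (sym r11) p))
      free : 0ℤ ℤ.< m 16 → Achieves done m 1 R
      free pos = achieves-done
        (trans r19 (sym (cong +_ (weight-free (suc q) b ℓ≤a (sub-pos⁻¹ (subst (0ℤ ℤ.<_) r16 pos))))) , agree-refl)
      shrink : ¬ (0ℤ ℤ.< m 16) → Achieves (div 19 19 1 ⨾ done) m 1 R
      shrink ¬pos′ = run-div {{nz}}
        (div-exact {{nz}} (weight (suc q) (suc b)) k
          (trans r19 (cong +_ (weight-divide (suc q) b (sub-nonpos⁻¹ (λ p → ¬pos′ (subst (0ℤ ℤ.<_) (sym r16) p))) b<p))) r1)
        (achieves-done (refl , agree-update 19 _ refl agree-refl))
        where
        nz : ℤ.NonZero (m 1)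
        nz = subst ℤ.NonZero (sym r1) (recompute-nonZero k)
          where
          recompute-nonZero : ∀ k .{{_ : NonZero k}} → NonZero k
          recompute-nonZero (suc _) = _

  inner-body : ∀ {q b m} → suc q + b < n → b < suc q → Inner (suc q + b) b m →
    Achieves innerBody m 22 (Inner (suc q + b) (suc b))
  inner-body {q} {b} {m} a<n b<p inv =
    run-arith at14 $ run-arith (cong (ℤ._+ + base q) r7) $
    run-load (suc (base q)) refl (1+base<space q<) (stale q b refl ≤-refl (<⇒≤ b<p)) $
    update-weight q b a<n b<p r1 letters r9 r11 r13 r16 refl λ m′ (w , ag) →
    run-store (suc (base q)) (at ag 18) (1+base<space q<) w $
    run-arith (cong₂ ℤ._+_ (trans (at ag 7) r7) (trans (at ag 13) r13)) $
    run-arith (cong (ℤ._+ + suc (base b)) (trans (at ag 7) r7)) $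
    run-load (2 + base b) refl (2+base<space b<) (unb m′ ag b (m<n+m b z<s)) $
    run-arith (trans (cong (λ x → + unbordered (suc b) ℤ.* x) w) (sym (ℤ.pos-* (unbordered (suc b)) W))) $
    run-arith (trans (cong (ℤ._+ + (unbordered (suc b) * W)) (trans (at ag 12) r12)) next-sum) $
    run-arith (cong₂ ℤ._+_ (trans (at ag 3) r3) (trans (at ag 13) r13)) $
    run-arith (trans (cong₂ ℤ._-_ (trans (at ag 15) r15) (trans (at ag 7) r7)) (sub-suc a (b + b))) $
    run-arith (trans (cong (λ x → + a ℤ.- + suc (b + b) ℤ.- x) (trans (at ag 7) r7))
      (trans (sub-suc a (suc (b + b))) (cong (λ x → + a ℤ.- + suc x) (sym (+-suc b b))))) $
    run-arith (trans (cong₂ ℤ._-_ (trans (at ag 16) r16) (trans (at ag 7) r7)) (sub-suc ℓ b)) $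
    achieves-done {Q = Inner a (suc b)} record
      { frame = record
        { r1 = trans (at ag 1) r1 ; r2 = trans (at ag 2) r2 ; r3 = trans (at ag 3) r3
        ; r7 = trans (at ag 7) r7 ; r8 = trans (at ag 8) r8
        ; letters = λ i i<ℓ → trans (lookup-other m′ (+ W) (base≢1+base i q)) (trans (at ag (base i)) (letters i i<ℓ))
        }
      ; r0 = trans (at ag 0) r0 ; r9 = trans (at ag 9) r9 ; r10 = trans (at ag 10) r10 ; r11 = trans (at ag 11) r11
      ; r12 = refl
      ; r13 = refl
      ; r14 = λ p eq → trans (at ag 14)
          (cong (λ x → + base x) {q} {p} (sym (+-cancelʳ-≡ (suc b) p q (trans eq (sym (+-suc q b))))))
      ; r15 = refl
      ; r16 = refl
      ; r17 = trans (at ag 17) r17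
      ; fresh = fresh′ m′ ag
      ; stale = λ q′ i eq b<i i≤p → trans (other m′ ag q′ i eq (>⇒≢ b<i)) (stale q′ i eq (<⇒≤ b<i) i≤p)
      ; unborders = unb m′ ag
      }
    where
    open Inner inv
    open Frame frame
    a W : ℕ
    a = suc q + b
    W = weight (suc q) (suc b)
    q< : q < n + 7
    q< = m≤n⇒m≤n+o 7 (≤-trans (s≤s (m≤n⇒m≤1+n (m≤m+n q b))) a<n)
    b< : b < n + 7
    b< = m≤n⇒m≤n+o 7 (≤-<-trans (m≤n+m b (suc q)) a<n)
    at14 : m 14 ℤ.- m 3 ≡ + base q
    at14 = cong₂ ℤ._-_ (r14 (suc q) refl) r3
    next-sum : + (∑< b (summand a) + unbordered (suc b) * W) ≡ + ∑< (suc b) (summand a)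
    next-sum = cong (λ p → + (∑< b (summand a) + unbordered (suc b) * weight p (suc b))) (sym (m+n∸n≡m (suc q) b))
    m₃ : Memory
    m₃ = ((m [ 14 ↦ + base q ]) [ 18 ↦ + suc (base q) ]) [ 19 ↦ + weight (suc q) b ]
    module _ (m′ : Memory) (ag : Agree 19 21 m₃ m′) where
      unb : ∀ i → i < a → (m′ [ suc (base q) ↦ + W ]) (2 + base i) ≡ + unbordered (suc i)
      unb i i<a = trans (lookup-other m′ (+ W) λ eq → base≢1+base q i (sym (suc-injective eq)))
        (trans (at ag (2 + base i)) (unborders i i<a))
      other : ∀ q′ i → suc q′ + i ≡ a → i ≢ b → (m′ [ suc (base q) ↦ + W ]) (suc (base q′)) ≡ m (suc (base q′))
      other q′ i eq i≢b = trans (lookup-other m′ (+ W) λ eq′ →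
          i≢b (+-cancelˡ-≡ (suc q) i b (trans (cong (λ x → suc x + i) (sym (base-injective q′ q (suc-injective eq′)))) eq)))
        (at ag (suc (base q′)))
      fresh′ : ∀ q′ i → suc q′ + i ≡ a → i < suc b →
        (m′ [ suc (base q) ↦ + W ]) (suc (base q′)) ≡ + weight (suc q′) (suc i)
      fresh′ q′ i eq i<1+b with m<1+n⇒m<n∨m≡n i<1+b
      ... | inj₁ i<b = trans (other q′ i eq (<⇒≢ i<b)) (fresh q′ i eq i<b)
      ... | inj₂ refl with refl ← +-cancelʳ-≡ b (suc q′) (suc q) eq =
        lookup-same m′ (suc (base q)) (+ W)

  inner-step : ∀ {a} → a < n → ∀ b m → b < ⌊ suc a /2⌋ → Inner a b m →
    (0ℤ ℤ.< m 15) × Achieves innerBody m 22 (Inner a (suc b))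
  inner-step {a} a<n b m b<h inv = positive , body
    where
    b+1+b≤a : b + suc b ≤ a
    b+1+b≤a = s≤s⁻¹ (i<⌊n/2⌋⇒2i+2≤n b<h)
    positive : 0ℤ ℤ.< m 15
    positive = subst (0ℤ ℤ.<_) (sym (Inner.r15 inv)) (sub-pos (subst (_≤ a) (+-suc b b) b+1+b≤a))
    body : Achieves innerBody m 22 (Inner a (suc b))
    body with q ← a ∸ suc b in q≡
      with refl ← trans (sym (m∸n+n≡m (m+n≤o⇒n≤o b b+1+b≤a))) (trans (cong (_+ suc b) q≡) (+-suc q b)) =
      inner-body a<n (s≤s (+-cancelʳ-≤ (suc b) b q (subst (b + suc b ≤_) (sym (+-suc q b)) b+1+b≤a))) inv

  inner-stop : ∀ {a} m → Inner a ⌊ suc a /2⌋ m → ¬ (0ℤ ℤ.< m 15)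
  inner-stop {a} m inv pos = sub-nonpos
    (≤-trans (≤-reflexive (sym (⌊n/2⌋+⌈n/2⌉≡n a))) (+-monoˡ-≤ ⌈ a /2⌉ (⌊n/2⌋≤⌈n/2⌉ a)))
    (subst (0ℤ ℤ.<_) (Inner.r15 inv) pos)

  record Outer (a : ℕ) (m : Memory) : Set where
    field
      frame : Frame m
      r0  : m 0 ≡ + n ℤ.- + a
      r9  : m 9 ≡ + base a
      r10 : m 10 ≡ + (k ^ (a ∸ ℓ))
      r11 : m 11 ≡ + ℓ ℤ.- + a
      r12 : m 12 ≡ + bordered a
      r17 : m 17 ≡ + a
      weights : ∀ q i → suc q + i ≡ a → i ≤ suc q → m (suc (base q)) ≡ + weight (suc q) i
      unborders : ∀ i → i < a → m (2 + base i) ≡ + unbordered (suc i)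

  outer-body : ∀ a m → a < n → Outer a m → Achieves outerBody m (19 + n * 24) (Outer (suc a))
  outer-body a m a<n inv = weaken time (achieves-ifpos 1 (5 + (⌊ suc a /2⌋ * 24 + 11)) (lit 11) inside beyond rest)
    where
    open Outer inv
    open Frame frame
    h K U : ℕ
    h = ⌊ suc a /2⌋
    K = k ^ (suc a ∸ ℓ)
    U = unbordered (suc a)
    time : 3 + (5 + (h * 24 + 11)) ≤ 19 + n * 24
    time = ≤-trans (≤-reflexive (solve 1 (λ x → con 8 :+ (x :* con 24 :+ con 11) := con 19 :+ x :* con 24) refl h))
      (+-monoʳ-≤ 19 (*-monoˡ-≤ 24 (≤-trans (⌊n/2⌋≤n (suc a)) a<n)))
      where open +-*-Solver
    R : Memory → Set
    R m′ = m′ 10 ≡ + K × Agree 10 10 m m′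
    inside : 0ℤ ℤ.< m 11 → Achieves done m 1 R
    inside pos = achieves-done (trans r10 (cong (λ e → + (k ^ e)) (trans (m≤n⇒m∸n≡0 (<⇒≤ a<ℓ)) (sym (m≤n⇒m∸n≡0 a<ℓ)))) , agree-refl)
      where
      a<ℓ : a < ℓ
      a<ℓ = sub-pos⁻¹ (subst (0ℤ ℤ.<_) r11 pos)
    beyond : ¬ (0ℤ ℤ.< m 11) → Achieves (arith mul 10 10 1 ⨾ done) m 1 R
    beyond ¬pos = run-arith
      (trans (cong₂ ℤ._*_ r10 r1) (trans (sym (ℤ.pos-* (k ^ (a ∸ ℓ)) k)) (cong +_ (trans (*-comm (k ^ (a ∸ ℓ)) k)
        (cong (k ^_) (sym (+-∸-assoc 1 ℓ≤a))))))) $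
      achieves-done (refl , agree-update 10 _ refl agree-refl)
      where
      ℓ≤a : ℓ ≤ a
      ℓ≤a = sub-nonpos⁻¹ (λ p → ¬pos (subst (0ℤ ℤ.<_) (sym r11) p))
    sub-bordered : + K ℤ.- + ∑< h (summand a) ≡ + U
    sub-bordered = begin
      + K ℤ.- + ∑< h (summand a)                    ≡⟨ cong₂ (λ x y → + x ℤ.- + y) (bordered+unbordered (suc a)) (bordered-rec (suc a)) ⟨
      + (bordered (suc a) + U) ℤ.- + bordered (suc a) ≡⟨ sub-≥ (m≤m+n (bordered (suc a)) U) ⟩
      + (bordered (suc a) + U ∸ bordered (suc a))     ≡⟨ cong +_ (m+n∸m≡n (bordered (suc a)) U) ⟩
      + U                                             ∎
      where open ≡-Reasoning
    finish : ∀ m → Inner a h m → Achieves _ m 9 (Outer (suc a))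
    finish m inn =
      run-arith (cong₂ ℤ._+_ i.r7 i.r9) $
      run-store (suc (base a)) refl (1+base<space a<) i.r10 $
      run-arith (cong (ℤ._+ + suc (base a)) i.r7) $
      run-arith (trans (cong₂ ℤ._-_ i.r10 i.r12) sub-bordered) $
      run-store (2 + base a) refl (2+base<space a<) refl $
      run-arith (cong₂ ℤ._+_ i.r3 i.r9) $
      run-arith (trans (cong₂ ℤ._-_ i.r11 i.r7) (sub-suc ℓ a)) $
      run-arith (cong₂ ℤ._+_ i.r7 i.r17) $
      run-arith (trans (cong₂ ℤ._-_ i.r0 i.r7) (sub-suc n a)) $
      achieves-done {Q = Outer (suc a)} record
        { frame = record
          { r1 = i.r1 ; r2 = i.r2 ; r3 = i.r3 ; r7 = i.r7 ; r8 = i.r8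
          ; letters = λ i i<ℓ → trans (lookup-other m₁ (+ U) (base≢2+base i a))
              (trans (lookup-other m (+ K) (base≢1+base i a)) (i.letters i i<ℓ))
          }
        ; r0 = refl ; r9 = refl ; r10 = i.r10 ; r11 = refl ; r12 = trans i.r12 (cong +_ (sym (bordered-rec (suc a))))
        ; r17 = refl
        ; weights = weights′
        ; unborders = unborders′
        }
      where
      module i where
        open Inner inn public
        open Frame (Inner.frame inn) public
      a< : a < n + 7
      a< = m≤n⇒m≤n+o 7 a<n
      m₁ m₂ : Memory
      m₁ = (m [ 18 ↦ + suc (base a) ]) [ suc (base a) ↦ + K ]
      m₂ = ((m₁ [ 18 ↦ + (2 + base a) ]) [ 19 ↦ + U ]) [ 2 + base a ↦ + U ]
      weights′ : ∀ q i → suc q + i ≡ suc a → i ≤ suc q → m₂ (suc (base q)) ≡ + weight (suc q) i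
      weights′ q i eq i≤p = trans (lookup-other m₁ (+ U) λ e → base≢1+base q a (suc-injective e)) (weights₁ q i eq i≤p)
        where
        weights₁ : ∀ q i → suc q + i ≡ suc a → i ≤ suc q → m₁ (suc (base q)) ≡ + weight (suc q) i
        -- The cell of p = a + 1 has just been created, with the power of k that is W(p, 0).
        weights₁ q zero eq _ with refl ← trans (sym (+-identityʳ q)) (suc-injective eq) =
          trans (lookup-same m (suc (base q)) (+ K)) (cong +_ (sym (weight-zero (suc q))))
        -- The bound i + 1 ≤ p puts i below ⌊(a + 1)/2⌋, so the inner loop did advance this cell.
        weights₁ q (suc i) eq i<p = trans
          (lookup-other m (+ K) λ e → <⇒≢ (subst (q <_) (suc-injective eq) (m<m+n q z<s)) (base-injective q a (suc-injective e)))
          (i.fresh q i (trans (sym (+-suc q i)) (suc-injective eq))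
            (2i≤n⇒i≤⌊n/2⌋ (≤-trans (+-monoˡ-≤ (suc i) i<p) (≤-reflexive eq))))
      unborders′ : ∀ i → i < suc a → m₂ (2 + base i) ≡ + unbordered (suc i)
      unborders′ i i<1+a with m<1+n⇒m<n∨m≡n i<1+a
      ... | inj₂ refl = lookup-same m₁ (2 + base a) (+ U)
      ... | inj₁ i<a  = trans
        (lookup-other m₁ (+ U) λ e → <⇒≢ i<a (base-injective i a (suc-injective (suc-injective e))))
        (trans (lookup-other m (+ K) λ e → base≢1+base a i (sym (suc-injective e))) (i.unborders i i<a))
    rest : ∀ m′ → R m′ → Achieves _ m′ (5 + (h * 24 + 11)) (Outer (suc a))
    rest m′ (K≡ , ag) =
      run-const $ run-move (trans (at ag 8) r8) $ run-move (trans (at ag 9) r9) $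
      run-move (trans (at ag 17) (trans r17 (sym (ℤ.+-identityʳ (+ a))))) $
      run-move (trans (at ag 2) (trans r2 (sym (ℤ.+-identityʳ (+ ℓ))))) $
      achieves-while (Inner a) h 22 9 (lit 15) (inner-step a<n) inner-stop
      (record
        { frame = record
          { r1 = trans (at ag 1) r1 ; r2 = trans (at ag 2) r2 ; r3 = trans (at ag 3) r3
          ; r7 = trans (at ag 7) r7 ; r8 = trans (at ag 8) r8
          ; letters = λ i i<ℓ → trans (at ag (base i)) (letters i i<ℓ)
          }
        ; r0 = trans (at ag 0) r0 ; r9 = trans (at ag 9) r9 ; r10 = K≡ ; r11 = trans (at ag 11) r11
        ; r12 = refl ; r13 = refl
        ; r14 = λ p eq → cong (λ x → + base x) {a} {p} (trans (sym eq) (+-identityʳ p))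
        ; r15 = refl ; r16 = refl ; r17 = trans (at ag 17) r17
        ; fresh = λ _ _ _ ()
        ; stale = λ q i eq _ i≤p → trans (at ag (suc (base q))) (weights q i eq i≤p)
        ; unborders = λ i i<a → trans (at ag (2 + base i)) (unborders i i<a)
        })
      finish

  -- Moving the letters out of the way.

  -- The bound n + 5 covers the letters of `u` as well as R₃ to R₈, which are saved even if `u` has
  -- fewer than six letters.
  record Saved (j : ℕ) (m : Memory) : Set where
    field
      r0 : m 0 ≡ + base j
      r1 : m 1 ≡ + k
      r2 : m 2 ≡ + ℓ
      r3 : m 3 ≡ + 3
      copied : ∀ i → i < j → m (base i) ≡ letterAt u i
      uncopied : ∀ i → j + i ≤ n + 5 → m (3 + (j + i)) ≡ letterAt u (j + i)

  -- The sources lie below the whole target area, so no letter is overwritten by a copy before it is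
  -- read.
  8+n<base : ∀ j {i} → i ≤ n + 5 → 3 + i < base j
  8+n<base j {i} i≤ = ≤-trans (+-monoʳ-≤ 4 i≤) (begin
    4 + (suc n′ + 5)     ≡⟨ solve 1 (λ x → con 4 :+ (con 1 :+ x :+ con 5) := con 10 :+ x) refl n′ ⟩
    10 + n′              ≤⟨ +-mono-≤ (m≤m+n 10 54) (m≤m*n n′ 64) ⟩
    64 + n′ * 64         ≤⟨ +-monoʳ-≤ 64 (m≤n+m (n′ * 64) (j * 3)) ⟩
    base j               ∎)
    where
    open ≤-Reasoning
    open +-*-Solver

  copied-suc : ∀ {j} m → (∀ i → i < j → m (base i) ≡ letterAt u i) →
    ∀ i → i < suc j → (m [ base j ↦ letterAt u j ]) (base i) ≡ letterAt u i
  copied-suc {j} m copied i i<1+j with m<1+n⇒m<n∨m≡n i<1+j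
  ... | inj₁ i<j  = trans (lookup-other m _ λ e → <⇒≢ i<j (base-injective i j e)) (copied i i<j)
  ... | inj₂ refl = lookup-same m (base j) _

  uncopied-suc : ∀ {j} m → (∀ i → j + i ≤ n + 5 → m (3 + (j + i)) ≡ letterAt u (j + i)) →
    ∀ i → suc j + i ≤ n + 5 → (m [ base j ↦ letterAt u j ]) (3 + (suc j + i)) ≡ letterAt u (suc j + i)
  uncopied-suc {j} m uncopied i le = trans (lookup-other m _ (<⇒≢ (8+n<base j le)))
    (subst (λ x → m (3 + x) ≡ letterAt u x) (+-suc j i) (uncopied (suc i) (subst (_≤ n + 5) (sym (+-suc j i)) le)))

  save : ∀ j → j ≤ 5 → Saved j m → (∀ m′ → Saved (suc j) m′ → Achieves c m′ t Q) →
    Achieves (store 0 (3 + j) ⨾ arith add 0 3 0 ⨾ c) m (2 + t) Q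
  save {m = m} j j≤5 sv next =
    run-store (base j) {_} {<⇒<ᵇ (+-monoʳ-≤ 4 (≤-trans j≤5 (m≤m+n 5 55)))} r0
      (base<space (m≤n⇒m≤o+n n (s≤s (≤-trans j≤5 (n≤1+n 5)))))
      (subst (λ x → m (3 + x) ≡ letterAt u x) (+-identityʳ j) (uncopied 0 (≤-trans (≤-reflexive (+-identityʳ j)) (≤-trans j≤5 (m≤n+m 5 n))))) $
    run-arith (cong₂ ℤ._+_ r3 r0) $
    next _ record { r0 = refl ; r1 = r1 ; r2 = r2 ; r3 = r3 ; copied = copied-suc m copied ; uncopied = uncopied-suc m uncopied }
    where
    open Saved sv

  record Copying (i : ℕ) (m : Memory) : Set where
    field
      saved : Saved (6 + i) m
      r4 : m 4 ≡ + (9 + i)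
      r5 : m 5 ≡ + ℓ ℤ.- + (6 + i)
      r7 : m 7 ≡ + 1
      r8 : m 8 ≡ + base 0

  copy-step : ∀ i m → i < ℓ ∸ 6 → Copying i m → (0ℤ ℤ.< m 5) × Achieves copyBody m 5 (Copying (suc i))
  copy-step i m i<ℓ∸6 inv = subst (0ℤ ℤ.<_) (sym r5) (sub-pos 6+i<ℓ) ,
    (run-load (9 + i) r4 (8+n<base (n + 7) 6+i≤n+5)
      (subst (λ x → m (3 + x) ≡ letterAt u x) (+-identityʳ (6 + i)) (uncopied 0 (subst (_≤ n + 5) (sym (+-identityʳ (6 + i))) 6+i≤n+5))) $
    run-store (base (6 + i)) r0 (base<space (m≤n⇒m≤n+o 7 (≤-trans 6+i<ℓ u≤n))) refl $
    run-arith (cong₂ ℤ._+_ r3 r0) $ run-arith (cong₂ ℤ._+_ r7 r4) $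
    run-arith (trans (cong₂ ℤ._-_ r5 r7) (sub-suc ℓ (6 + i))) $
    achieves-done {Q = Copying (suc i)} record
      { saved = record
        { r0 = refl ; r1 = r1 ; r2 = r2 ; r3 = r3
        ; copied = copied-suc m copied ; uncopied = uncopied-suc m uncopied }
      ; r4 = refl ; r5 = refl ; r7 = r7 ; r8 = r8
      })
    where
    open Copying inv
    open Saved saved
    6+i<ℓ : 6 + i < ℓ
    6+i<ℓ = ≰⇒> λ ℓ≤6+i → <⇒≱ i<ℓ∸6 (m≤n+o⇒m∸n≤o ℓ 6 ℓ≤6+i)
    6+i≤n+5 : 6 + i ≤ n + 5
    6+i≤n+5 = m≤n⇒m≤n+o 5 (<⇒≤ (≤-trans 6+i<ℓ u≤n))

  copying-start : ∀ m → Saved 6 m → (∀ m′ → Copying (ℓ ∸ 6) m′ → Achieves c m′ t Q) →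
    Achieves (const 4 (+ 18) ⨾ arith sub 8 0 4 ⨾ const 4 (+ 9) ⨾ const 5 (+ 6) ⨾ arith sub 5 2 5 ⨾ const 7 (+ 1) ⨾
              while 5 copyBody c) m (6 + ((ℓ ∸ 6) * 7 + (2 + t))) Q
  copying-start {t = t} m sv next =
    run-const $ run-arith {v = + base 0} (cong (ℤ._- + 18) r0) $ run-const $ run-const $
    run-arith (cong (ℤ._- + 6) r2) $ run-const $
    achieves-while Copying (ℓ ∸ 6) 5 t (lit 5) copy-step
      (λ m inv pos → sub-nonpos (m≤n+m∸n ℓ 6) (subst (0ℤ ℤ.<_) (Copying.r5 inv) pos))
      (record
        { saved = record { r0 = r0 ; r1 = r1 ; r2 = r2 ; r3 = r3 ; copied = copied ; uncopied = uncopied }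
        ; r4 = refl ; r5 = refl ; r7 = refl ; r8 = refl })
      next
    where open Saved sv

  copyLetters-achieves : Saved 1 m → (∀ m′ → Copying (ℓ ∸ 6) m′ → Achieves c m′ t Q) →
    Achieves (copyLetters c) m (16 + ((ℓ ∸ 6) * 7 + (2 + t))) Q
  copyLetters-achieves s₁ next =
    save 1 (s≤s z≤n) s₁ λ _ s₂ → save 2 (s≤s (s≤s z≤n)) s₂ λ _ s₃ →
    save 3 (s≤s (s≤s (s≤s z≤n))) s₃ λ _ s₄ → save 4 (s≤s (s≤s (s≤s (s≤s z≤n)))) s₄ λ _ s₅ →
    save 5 ≤-refl s₅ λ m s₆ → copying-start m s₆ next

  relocate-achieves : (∀ m → Frame m → m 0 ≡ + n → Achieves c m t Q) →
    Achieves (relocate c) (input n k u) (25 + ((ℓ ∸ 6) * 7 + (2 + (2 + t)))) Q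
  relocate-achieves {c = c} {t = t} {Q = Q} next =
    -- Six doublings of n give n * 64, which computes to `base 0`.
    run-arith (trans (cong (λ x → + x ℤ.+ + x) (sym (*-identityʳ n))) (double 1)) $
    run-arith (double 2) $ run-arith (double 4) $ run-arith (double 8) $ run-arith (double 16) $ run-arith (double 32) $
    run-store {v = letterAt u 0} (base 0) refl (base<space (m≤n⇒m≤o+n n z<s)) refl $
    run-const $ run-arith {v = + base 1} refl $ copyLetters-achieves
      (record
        { r0 = refl ; r1 = refl ; r2 = refl ; r3 = refl
        ; copied = copied-suc (input n k u) (λ _ ()) ; uncopied = uncopied-suc (input n k u) (λ _ _ → refl) })
      finish
    where
    double : ∀ i → + (n * i) ℤ.+ + (n * i) ≡ + (n * (i + i))
    double i = cong +_ (sym (*-distribˡ-+ n i i))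
    finish : ∀ m → Copying (ℓ ∸ 6) m → Achieves (const 4 (+ 64) ⨾ div 0 8 4 ⨾ c) m (2 + t) Q
    -- R₈ still holds `base 0`, that is n * 64, so dividing it by 64 brings n back.
    finish m inv = run-const $ run-div {{_}} (div-exact {{_}} n 64 r8 refl) $ next _
      (record { r1 = r1 ; r2 = r2 ; r3 = r3 ; r7 = r7 ; r8 = r8
              ; letters = λ i i<ℓ → copied i (≤-trans i<ℓ (m≤n+m∸n ℓ 6)) })
      refl
      where
      open Copying inv
      open Saved saved

  -- Assembling the bounds.

  main-achieves : ∀ m → Frame m → m 0 ≡ + n →
    Achieves main m (5 + (n * (2 + (19 + n * 24)) + (2 + 1))) (λ m → m 0 ≡ + bordered n)
  main-achieves m fr m0 =
    run-move r8 $ run-const $ run-move (trans r2 (sym (ℤ.+-identityʳ (+ ℓ)))) $ run-const $ run-const $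
    achieves-while Outer n (19 + n * 24) 1 (lit 0)
      (λ a m a<n inv → subst (0ℤ ℤ.<_) (sym (Outer.r0 inv)) (sub-pos a<n) , outer-body a m a<n inv)
      (λ m inv pos → sub-nonpos {n} {n} ≤-refl (subst (0ℤ ℤ.<_) (Outer.r0 inv) pos))
      (record
        { frame = record { r1 = r1 ; r2 = r2 ; r3 = r3 ; r7 = r7 ; r8 = r8 ; letters = letters }
        ; r0 = trans m0 (sym (ℤ.+-identityʳ (+ n))) ; r9 = refl
        ; r10 = cong (λ e → + (k ^ e)) (sym (0∸n≡0 ℓ))
        ; r11 = refl ; r12 = cong +_ (sym (bordered-rec 0)) ; r17 = refl
        ; weights = λ _ _ () ; unborders = λ _ () })
      λ m inv → run-move (Outer.r12 inv) (achieves-done refl)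
    where open Frame fr

  space-bound : space ≤ 88 * n
  space-bound = begin
    -- `space` equals 88 + 67n′, and 21n′ completes it to 88n.
    space             ≤⟨ m≤m+n space (n′ * 21) ⟩
    space + n′ * 21   ≡⟨ solve 1 (λ x → con 64 :+ ((con 1 :+ x :+ con 7) :* con 3 :+ x :* con 64) :+ x :* con 21
                           := (con 1 :+ x) :* con 88) refl n′ ⟩
    n * 88            ≡⟨ *-comm n 88 ⟩
    88 * n            ∎
    where
    open ≤-Reasoning
    open +-*-Solver

  correct : ∃[ t ] ∃[ s ] t ≤ 90 * n ^ 2 × s ≤ 88 * n ×
            countBordered On input n k u Computes (+ B k u n) InTime t Space s
  correct = conclude (achieves⇒halts (relocate main) (input n k u) _ _ (relocate-achieves main-achieves))
    where
    conclude : (∃[ t ] ∃[ m ] t ≤ timeBound (ℓ ∸ 6) n × m 0 ≡ + bordered n × countBordered ⊢ (0 , input n k u) ⇓⟨ t , space ⟩ m) →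
      ∃[ t ] ∃[ s ] t ≤ 90 * n ^ 2 × s ≤ 88 * n × countBordered On input n k u Computes (+ B k u n) InTime t Space s
    conclude (t , m , t≤ , m0 , halts) =
      t , space , ≤-trans t≤ (timeBound-quadratic (ℓ ∸ 6) n z<s (≤-trans (m∸n≤m ℓ 6) u≤n)) , space-bound ,
      m , halts , trans m0 (cong +_ (sym (B≡bordered u≤n)))

theorem6 : ∃[ P ] ∃[ c ] ∃[ d ]
    (∀ (n k : ℕ) → 1 ≤ n → 2 ≤ k → (u : Word k) → length u ≤ n →
    ∃[ t ] ∃[ s ] t ≤ c * n ^ 2 × s ≤ d * n ×
    P On input n k u Computes (+ B k u n) InTime t Space s)
theorem6 = countBordered , 90 , 88 ,
  λ { (suc n′) k@(suc _) _ _ u u≤n → Correctness.correct n′ k u u≤n }
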